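{- Let $n\ge1$ and let $P\subseteq \mathbb{Z}^{n}_{\geq 0}$ be a polymatroid. Then (i) the sequence $[y^{0}]X_{P}(y),[y^{1}]X_{P}(y),\ldots,[y^{r_{2}(P)-1}]X_{P}(y)$ is unimodal; (ii) the sequence $[x^{0}]I_{P}(x),[x^{1}]I_{P}(x),\ldots,[x^{r'_{2}(P)-1}]I_{P}(x)$ is unimodal.
   Context: A rank function on $[n]$ is $f:2^{[n]}\to\mathbb{Z}_{\ge0}$ with $f(\emptyset)=0$, monotone, and submodular. The polymatroid with rank function $f$ is $P=\{\mathbf a\in\mathbb{Z}^n_{\ge 0}:\ \sum_{i\in I}a_i\le f(I)\ \forall I\subseteq[n],\ \sum_{i\in[n]}a_i=f([n])\}$. With $\mathbf e_1,\dots,\mathbf e_n$ the standard basis, for $\mathbf a\in P$ an index $i$ is internally active if $\mathbf a-\mathbf e_i+\mathbf e_j\notin P$ for all $j<i$, and externally active if $\mathbf a+\mathbf e_i-\mathbf e_j\notin P$ for all $j<i$; $\mathrm{Int}(\mathbf a),\mathrm{Ext}(\mathbf a)$ denote these sets. $I_P(x)=\sum_{\mathbf a\in P}x^{n-|\mathrm{Int}(\mathbf a)|}$, $X_P(y)=\sum_{\mathbf a\in P}y^{n-|\mathrm{Ext}(\mathbf a)|}$; $[y^i]p$ is the coefficient of $y^i$. $r_{2}(P)=\min\{n-|F|:\ F\subseteq [n],\ f(F)\leq f([n])-2\}$ and $r'_{2}(P)=\min\{|F|:\ F\subseteq [n],\ \sum_{i'\in F}f(\{i'\})-f(F)\geq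 2\}$. A real sequence $a_0,\dots,a_m$ is unimodal if there is an integer $k$ with $a_i\le a_{i+1}$ for $i<k$ and $a_i\ge a_{i+1}$ for $i>k$. -}

module Defs where

open import Data.Nat using (ℕ; zero; suc; _+_; _∸_; _≤_; _<_; _≤ᵇ_; _<ᵇ_; _≡ᵇ_)
open import Data.Bool using (Bool; true; false; _∧_; if_then_else_)
open import Data.Fin using (Fin; toℕ)
open import Data.Fin.Subset using (Subset; ⊥; ⊤; ⁅_⁆; _⊆_; _∪_; _∩_; ∣_∣; inside; outside)
open import Data.Vec using (Vec; []; _∷_; lookup; updateAt; zipWith; foldr; tabulate)
import Data.Nat
import Data.Bool
import Data.List
open import Data.List using (List; map; concatMap; filter; length; upTo)
  renaming (_∷_ to _∷ₗ_; [] to []ₗ)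
open import Data.Maybe using (Maybe; just; nothing)
open import Data.Product using (_×_; Σ; ∃)
open import Relation.Binary.PropositionalEquality using (_≡_)
open import Relation.Nullary.Decidable using (⌊_⌋)

record IsRankFunction (n : ℕ) (f : Subset n → ℕ) : Set where
  field
    f-empty     : f ⊥ ≡ 0
    monotone    : ∀ (A B : Subset n) → A ⊆ B → f A ≤ f B
    submodular  : ∀ (A B : Subset n) → f (A ∪ B) + f (A ∩ B) ≤ f A + f B

allᵇ : {A : Set} → (A → Bool) → List A → Bool
allᵇ p []ₗ = true
allᵇ p (x ∷ₗ xs) = p x ∧ allᵇ p xs

allSubsets : (n : ℕ) → List (Subset n)
allSubsets zero = [] ∷ₗ []ₗ
allSubsets (suc n) =
  concatMap (λ S → (inside ∷ S) ∷ₗ ((outside ∷ S) ∷ₗ []ₗ)) (allSubsets n)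

box : (n N : ℕ) → List (Vec ℕ n)
box zero N = [] ∷ₗ []ₗ
box (suc n) N = concatMap (λ v → map (λ x → x ∷ v) (upTo (suc N))) (box n N)

sumOver : {n : ℕ} → Subset n → Vec ℕ n → ℕ
sumOver I a = foldr _ _+_ 0 (zipWith (λ b x → if b then x else 0) I a)

total : {n : ℕ} → Vec ℕ n → ℕ
total a = sumOver ⊤ a

inP : {n : ℕ} → (Subset n → ℕ) → Vec ℕ n → Bool
inP {n} f a = allᵇ (λ I → sumOver I a ≤ᵇ f I) (allSubsets n) ∧ (total a ≡ᵇ f ⊤)

-- membership of an integer vector that may have a negative entry
-- (represented by 'nothing'); such vectors are never in P ⊆ ℤ^n_{≥0}.
inP? : {n : ℕ} → (Subset n → ℕ) → Maybe (Vec ℕ n) → Bool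
inP? f nothing  = false
inP? f (just a) = inP f a

minusPlus : {n : ℕ} → Vec ℕ n → Fin n → Fin n → Maybe (Vec ℕ n)
minusPlus a i j with lookup a i
... | zero  = nothing
... | suc _ = just (updateAt (updateAt a i (λ x → x ∸ 1)) j suc)

-- Since P is contained in {0,…,f([n])}^n, every element of P lies in this list.
elemsP : {n : ℕ} → (Subset n → ℕ) → List (Vec ℕ n)
elemsP {n} f = filter (λ a → Data.Bool._≟_ (inP f a) true) (box n (f ⊤))

intActive : {n : ℕ} → (Subset n → ℕ) → Vec ℕ n → Fin n → Bool
intActive {n} f a i =
  allᵇ (λ j → if toℕ j <ᵇ toℕ i then (if inP? f (minusPlus a i j) then false else true) else true)
      (Data.List.allFin n)

extActive : {n : ℕ} → (Subset n → ℕ) → Vec ℕ n → Fin n → Bool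
extActive {n} f a i =
  allᵇ (λ j → if toℕ j <ᵇ toℕ i then (if inP? f (minusPlus a j i) then false else true) else true)
      (Data.List.allFin n)

Int : {n : ℕ} → (Subset n → ℕ) → Vec ℕ n → Subset n
Int f a = tabulate (intActive f a)

Ext : {n : ℕ} → (Subset n → ℕ) → Vec ℕ n → Subset n
Ext f a = tabulate (extActive f a)

-- Coefficients of I_P(x) = Σ_{a∈P} x^{n-|Int(a)|} and X_P(y) = Σ_{a∈P} y^{n-|Ext(a)|}

coeffI : {n : ℕ} → (Subset n → ℕ) → ℕ → ℕ
coeffI {n} f k = length (filter (λ a → Data.Nat._≟_ (n ∸ ∣ Int f a ∣) k) (elemsP f))

coeffX : {n : ℕ} → (Subset n → ℕ) → ℕ → ℕ
coeffX {n} f k = length (filter (λ a → Data.Nat._≟_ (n ∸ ∣ Ext f a ∣) k) (elemsP f))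

-- r₂ and r'₂ (minimum over a finite family; the empty minimum is read
-- as ∞, encoded as n + 1, which makes the sequence below the full
-- coefficient sequence of degrees 0..n).

minOr : ℕ → List ℕ → ℕ
minOr d []ₗ = d
minOr d (x ∷ₗ xs) = Data.Nat._⊓_ x (minOr d xs)

r₂ : {n : ℕ} → (Subset n → ℕ) → ℕ
r₂ {n} f = minOr (suc n)
  (map (λ F → n ∸ ∣ F ∣) (filter (λ F → Data.Nat._≤?_ (f F + 2) (f ⊤)) (allSubsets n)))

singletonSum : {n : ℕ} → (Subset n → ℕ) → Subset n → ℕ
singletonSum f F = sumOver F (tabulate (λ i → f ⁅ i ⁆))

r₂′ : {n : ℕ} → (Subset n → ℕ) → ℕ
r₂′ {n} f = minOr (suc n)
  (map ∣_∣ (filter (λ F → Data.Nat._≤?_ (f F + 2) (singletonSum f F)) (allSubsets n)))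

-- Unimodality of the finite sequence s 0, …, s (m-1).
-- (The peak index k is taken in ℕ; a negative integer k is never needed,
-- since k = 0 imposes weaker conditions than any k < 0.)

Unimodal : ℕ → (ℕ → ℕ) → Set
Unimodal m s = ∃ λ (k : ℕ) →
  (∀ i → i < k → suc i < m → s i ≤ s (suc i)) ×
  (∀ i → k < i → suc i < m → s (suc i) ≤ s i)

{-# OPTIONS --safe #-}
module Submission where

-- Slicing P by its last coordinate x gives X_P = X_{x = max} + y Σ_{x < max} X_{P_x}: the last
-- index is externally active exactly when x is maximal, and the activity of the other indices is
-- that in the slice. By induction this yields, in degrees below r₂,
--   X_P(y) = (1 - y)^(- r) (1 - Σ_A y^(n - |A|)),   r = f ⊤,
-- where A runs over the maximal subsets with f A < r; submodularity makes a subset of rank r - 1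
-- and codimension below r₂ lie in at most one such A. The coefficients of the second factor
-- are ≥ 0 at degree 0 and ≤ 0 afterwards, and forming partial sums preserves having at most one
-- sign change from + to -. As the r-fold partial sums of that factor have the (r - 1)-fold
-- ones as differences, they are unimodal.
-- The interior polynomial of P is the exterior polynomial of the dual { m - a : a ∈ P } with
-- m i = f ⁅ i ⁆, and r₂′ of P bounds r₂ of the dual.

open import Defs
open import Data.Bool using (Bool; true; false; _∧_; _∨_; not; if_then_else_)
import Data.Bool as Bool
import Data.Bool.Properties as Bool
open import Data.Empty using (⊥-elim)
open import Data.Fin using (Fin; zero; suc; toℕ; inject₁; fromℕ)
import Data.Fin as Fin
import Data.Fin.Properties as Fin
open import Data.Fin.Relation.Unary.Top using (view; ‵fromℕ; ‵inject₁)
open import Data.Fin.Subset using (Subset; ⊥; ⊤; ⁅_⁆; _⊆_; _∪_; _∩_; ∣_∣; inside; outside; ∁)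
open import Data.Fin.Subset.Properties
  using (out⊆; s⊆s; drop-∷-⊆; ∣p∣≤n; ⊆-refl; ⊆-max; ⊆-min; ⊆-antisym; ∣⊤∣≡n; p⊆q⇒∣p∣≤∣q∣;
         ∪-identityˡ; ∪-identityʳ; q⊆p∪q; p∩q⊆p; x∈p∩q⁺; x∈p∪q⁺; _∈?_; x∉p⇒x∈∁p; p∪∁p≡⊤;
         ∣∁p∣≡n∸∣p∣; ∪-∩-booleanAlgebra; anySubset?)
open import Data.Integer using (ℤ; +_; 0ℤ)
  renaming (_+_ to _+ᶻ_; _-_ to _-ᶻ_; _≤_ to _≤ᶻ_)
import Data.Integer as ℤ
import Data.Integer.Properties as ℤ
import Data.Integer.Solver as ℤSolver
open import Data.List using (List; map; concatMap; filter; length; upTo; applyUpTo; allFin; _++_)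
  renaming (_∷_ to _∷ₗ_; [] to []ₗ; tabulate to tabulateₗ)
open import Data.List.Membership.Propositional renaming (_∈_ to _∈ₗ_)
open import Data.List.Membership.Propositional.Properties using (∈-map⁺; ∈-filter⁺; ∈-concatMap⁺)
open import Data.List.Properties using (map-applyUpTo; map-++; map-∘)
import Data.List.Relation.Unary.Any as Any
open import Data.Maybe using (just; nothing)
open import Data.Nat using (ℕ; zero; suc; _+_; _∸_; _≤_; _<_; z≤n; s≤s; _⊓_; _<ᵇ_; _≡ᵇ_)
import Data.Nat as ℕ
open import Data.Nat.ListAction using (sum)
open import Data.Nat.ListAction.Properties using (sum-++)
import Data.Nat.Properties as ℕ
import Data.Nat.Solver as ℕSolver
open import Data.Product using (_×_; _,_; ∃; proj₁; proj₂)
open import Data.Sum using (_⊎_; inj₁; inj₂)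
open import Data.Vec
  using (Vec; []; _∷_; _∷ʳ_; here; init; last; initLast; lookup; updateAt; tabulate; zipWith; replicate)
open import Data.Vec.Properties
  using (init-∷ʳ; last-∷ʳ; lookup-zipWith; lookup-replicate; lookup∘tabulate; lookup∘updateAt;
         lookup∘updateAt′; updateAt-commutes; tabulate-cong; map-replicate)
open import Function using (_∘_; id; mk⇔; Equivalence)
open import Relation.Binary.PropositionalEquality
open import Relation.Nullary using (yes; no; ¬_)
open import Relation.Nullary.Decidable using (_×-dec_)

-- Activity compares an index only with smaller ones: the last index is tested against all others
-- and never enters their tests, which is why the last coordinate is the one to slice off. Write β
-- for its largest value, F for the family of non-spanning sets, and e₁, e₀ for the series of
-- `F ↾ inside` and `F ↾ outside`. In low degree the slice at any x > 0 has rank r - x and the same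
-- non-spanning family `F ↾ inside`; only at x = 0 < β is it `F ↾ outside`. The slices therefore
-- contribute (1 - y)^(-(r - β)) e₁ at the top, y (1 - y)^(-(r - x)) e₁ for 0 < x < β, and y (1 -
-- y)^(-r) e₀ at 0. The terms in e₁ telescope, and the total is (1 - y)^(-r) (e₁ + y (e₀ - e₁));
-- `series-rec` identifies the second factor with the series of F. Coefficient k of a shift or a
-- partial sum depends only on coefficients up to k, so all of this survives truncation below a
-- fixed degree.

Seq : Set
Seq = ℕ → ℤ

-- Sequences stand for power series in y: shift multiplies by y and psum by 1 / (1 - y).
shift : Seq → Seq
shift u zero = 0ℤ
shift u (suc k) = u k

psum : Seq → Seq
psum u zero = u zero
psum u (suc k) = psum u k +ᶻ u (suc k)

psums : ℕ → Seq → Seq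
psums zero u = u
psums (suc r) u = psum (psums r u)

_≗[_]_ : Seq → ℕ → Seq → Set
u ≗[ m ] v = ∀ k → k < m → u k ≡ v k

shift-local : ∀ {u v m} → (∀ k → suc k < m → u k ≡ v k) → shift u ≗[ m ] shift v
shift-local h zero _ = refl
shift-local h (suc k) k<m = h k k<m

psum-local : ∀ {u v m} → u ≗[ m ] v → psum u ≗[ m ] psum v
psum-local h zero k<m = h zero k<m
psum-local h (suc k) k<m =
  cong₂ _+ᶻ_ (psum-local h k (ℕ.<-trans (ℕ.n<1+n k) k<m)) (h (suc k) k<m)

psums-local : ∀ r {u v m} → u ≗[ m ] v → psums r u ≗[ m ] psums r v
psums-local zero h = h
psums-local (suc r) h = psum-local (psums-local r h)

psum-step : ∀ u k → psum u k ≡ u k +ᶻ shift (psum u) k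
psum-step u zero = sym (ℤ.+-identityʳ (u zero))
psum-step u (suc k) = ℤ.+-comm (psum u k) (u (suc k))

psum-shift : ∀ u k → psum (shift u) k ≡ shift (psum u) k
psum-shift u zero = refl
psum-shift u (suc zero) = ℤ.+-identityˡ (u zero)
psum-shift u (suc (suc k)) = cong (_+ᶻ u (suc k)) (psum-shift u (suc k))

psum-affine : ∀ {u v w x} → (∀ k → u k ≡ v k +ᶻ (w k -ᶻ x k)) →
  ∀ k → psum u k ≡ psum v k +ᶻ (psum w k -ᶻ psum x k)
psum-affine h zero = h zero
psum-affine {u} {v} {w} {x} h (suc k) = begin
  psum u k +ᶻ u (suc k)
    ≡⟨ cong₂ _+ᶻ_ (psum-affine h k) (h (suc k)) ⟩
  (psum v k +ᶻ (psum w k -ᶻ psum x k)) +ᶻ (v (suc k) +ᶻ (w (suc k) -ᶻ x (suc k)))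
    ≡⟨ solve 6 (λ a b c d e f → (a :+ (b :- c)) :+ (d :+ (e :- f)) := (a :+ d) :+ ((b :+ e) :- (c :+ f)))
         refl (psum v k) (psum w k) (psum x k) (v (suc k)) (w (suc k)) (x (suc k)) ⟩
  psum v (suc k) +ᶻ (psum w (suc k) -ᶻ psum x (suc k)) ∎
  where open ≡-Reasoning
        open ℤSolver.+-*-Solver

-- Multiplication by y commutes with division by 1 - y, so the relation may be divided through by (1
-- - y)^r.
psums-affine : ∀ r {u v w x} → (∀ k → u k ≡ v k +ᶻ (shift w k -ᶻ shift x k)) →
  ∀ k → psums r u k ≡ psums r v k +ᶻ (shift (psums r w) k -ᶻ shift (psums r x) k)
psums-affine zero h = h
psums-affine (suc r) {u} {v} {w} {x} h k = trans
  (psum-affine (psums-affine r h) k)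
  (cong₂ (λ a b → psums (suc r) v k +ᶻ (a -ᶻ b)) (psum-shift (psums r w) k) (psum-shift (psums r x) k))

psums-zero : ∀ r k → psums r (λ _ → 0ℤ) k ≡ 0ℤ
psums-zero zero k = refl
psums-zero (suc r) zero = psums-zero r 0
psums-zero (suc r) (suc k) = cong₂ _+ᶻ_ (psums-zero (suc r) k) (psums-zero r (suc k))

-- Sign changes and unimodality

SignChange : ℕ → Seq → Set
SignChange m u = ∃ λ p →
  (∀ i → i < p → i < m → 0ℤ ≤ᶻ u i) × (∀ i → p ≤ i → i < m → u i ≤ᶻ 0ℤ)

antitone-from : ∀ {v : Seq} {p} m → (∀ i → p ≤ suc i → suc i < m → v (suc i) ≤ᶻ v i) →
  ∀ {i} j → p ≤ i → i ≤ j → j < m → v j ≤ᶻ v i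
antitone-from m dec zero p≤i z≤n j<m = ℤ.≤-refl
antitone-from m dec {i} (suc j) p≤i i≤j j<m with ℕ.m≤n⇒m<n∨m≡n i≤j
... | inj₂ refl = ℤ.≤-refl
... | inj₁ (s≤s i≤j′) = ℤ.≤-trans
  (dec j (ℕ.≤-trans p≤i i≤j) j<m)
  (antitone-from m dec j p≤i i≤j′ (ℕ.<-trans (ℕ.n<1+n j) j<m))

-- Induction on the window. If its last value is nonnegative, the descent makes every earlier value
-- past `p` nonnegative too; otherwise the shorter window is split and the last index joins the
-- nonpositive part.
signChange-of-descent : ∀ {v : Seq} {p} m → (∀ i → i < p → i < m → 0ℤ ≤ᶻ v i) →
  (∀ i → p ≤ suc i → suc i < m → v (suc i) ≤ᶻ v i) → SignChange m v
signChange-of-descent zero pos dec = 0 , (λ _ ()) , λ _ _ ()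
signChange-of-descent {v} {p} (suc m) pos dec with 0ℤ ℤ.≤? v m
... | yes 0≤vm = suc m , (λ i i<sm _ → nonneg i (ℕ.≤-pred i<sm)) , λ i sm≤i i<sm → ⊥-elim (ℕ.<⇒≱ i<sm sm≤i)
  where
  nonneg : ∀ i → i ≤ m → 0ℤ ≤ᶻ v i
  nonneg i i≤m with i ℕ.<? p
  ... | yes i<p = pos i i<p (s≤s i≤m)
  ... | no i≮p = ℤ.≤-trans 0≤vm (antitone-from (suc m) dec m (ℕ.≮⇒≥ i≮p) i≤m (ℕ.n<1+n m))
... | no 0≰vm with signChange-of-descent {v} {p} m (λ i i<p i<m → pos i i<p (ℕ.m<n⇒m<1+n i<m)) (λ i p≤i i<m → dec i p≤i (ℕ.m<n⇒m<1+n i<m))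
-- Nothing in the type bounds `q` by the shorter window; the cap at `m` puts index `m` on the
-- nonpositive side.
... | q , nonneg , nonpos = q ⊓ m
      , (λ i i<q⊓m _ → nonneg i (ℕ.<-≤-trans i<q⊓m (ℕ.m⊓n≤m q m)) (ℕ.<-≤-trans i<q⊓m (ℕ.m⊓n≤n q m)))
      , below
  where
  below : ∀ i → q ⊓ m ≤ i → i < suc m → v i ≤ᶻ 0ℤ
  below i q⊓m≤i (s≤s i≤m) with ℕ.m≤n⇒m<n∨m≡n i≤m
  ... | inj₂ refl = ℤ.<⇒≤ (ℤ.≰⇒> 0≰vm)
  ... | inj₁ i<m with q ℕ.≤? i
  ...   | yes q≤i = nonpos i q≤i i<m
  ...   | no q≰i = ⊥-elim (ℕ.<⇒≱ (ℕ.⊓-pres-m< (ℕ.≰⇒> q≰i) i<m) q⊓m≤i)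

psum-signChange : ∀ {m u} → SignChange m u → SignChange m (psum u)
psum-signChange {m} {u} (p , pos , neg) = signChange-of-descent {p = p} m nonneg descent
  where
  nonneg : ∀ i → i < p → i < m → 0ℤ ≤ᶻ psum u i
  nonneg zero i<p i<m = pos 0 i<p i<m
  nonneg (suc i) i<p i<m = ℤ.+-mono-≤
    (nonneg i (ℕ.<-trans (ℕ.n<1+n i) i<p) (ℕ.<-trans (ℕ.n<1+n i) i<m)) (pos (suc i) i<p i<m)
  descent : ∀ i → p ≤ suc i → suc i < m → psum u (suc i) ≤ᶻ psum u i
  descent i p≤i i<m = subst (psum u (suc i) ≤ᶻ_) (ℤ.+-identityʳ (psum u i))
    (ℤ.+-monoʳ-≤ (psum u i) (neg (suc i) p≤i i<m))

psums-signChange : ∀ {m u} r → SignChange m u → SignChange m (psums r u)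
psums-signChange zero h = h
psums-signChange (suc r) h = psum-signChange (psums-signChange r h)

psums-unimodal : ∀ m r (u : Seq) (s : ℕ → ℕ) → 0ℤ ≤ᶻ u 0 → (∀ k → u (suc k) ≤ᶻ 0ℤ) →
  (∀ k → k < m → + s k ≡ psums r u k) → Unimodal m s
psums-unimodal m zero u s u₀ uₛ eq =
  0 , (λ _ ()) , λ i _ i<m → ℕ.≤-trans (ℤ.drop‿+≤+ (subst (_≤ᶻ 0ℤ) (sym (eq (suc i) i<m)) (uₛ i))) z≤n
psums-unimodal m (suc r) u s u₀ uₛ eq with psums-signChange {m} r (1 , start , rest)
  where
  start : ∀ i → i < 1 → i < m → 0ℤ ≤ᶻ u i
  start zero _ _ = u₀
  start (suc _) (s≤s ())
  rest : ∀ i → 1 ≤ i → i < m → u i ≤ᶻ 0ℤ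
  rest (suc i) _ _ = uₛ i
-- The step from `s i` to `s (suc i)` is `t (suc i)`, so the peak lies one below the sign change.
-- For p = 0 truncation gives peak 0, and `s` only descends.
... | p , pos , neg = p ∸ 1 , up , down
  where
  t : Seq
  t = psums r u
  up : ∀ i → i < p ∸ 1 → suc i < m → s i ≤ s (suc i)
  up i i<p i<m = ℤ.drop‿+≤+ (subst₂ _≤ᶻ_
    (trans (ℤ.+-identityʳ _) (sym (eq i (ℕ.<-trans (ℕ.n<1+n i) i<m)))) (sym (eq (suc i) i<m))
    (ℤ.+-monoʳ-≤ (psum t i) (pos (suc i) (ℕ.<-≤-trans (s≤s i<p) (1+pred≤ (ℕ.≤-<-trans z≤n i<p))) i<m)))
    where
    1+pred≤ : ∀ {p} → 0 < p ∸ 1 → suc (p ∸ 1) ≤ p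
    1+pred≤ {suc p} _ = ℕ.≤-refl
  down : ∀ i → p ∸ 1 < i → suc i < m → s (suc i) ≤ s i
  down i p<i i<m = ℤ.drop‿+≤+ (subst₂ _≤ᶻ_
    (sym (eq (suc i) i<m)) (trans (ℤ.+-identityʳ _) (sym (eq i (ℕ.<-trans (ℕ.n<1+n i) i<m))))
    (ℤ.+-monoʳ-≤ (psum t i) (neg (suc i) (ℕ.≤-trans (ℕ.m≤n+m∸n p 1) (ℕ.m≤n⇒m≤1+n p<i)) i<m)))

-- Telescoping over the slices

sumBelow : ℕ → (ℕ → ℤ) → ℤ
sumBelow zero F = 0ℤ
sumBelow (suc b) F = F 0 +ᶻ sumBelow b (λ t → F (suc t))

sumBelow-cong : ∀ b {F G} → (∀ t → t < b → F t ≡ G t) → sumBelow b F ≡ sumBelow b G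
sumBelow-cong zero h = refl
sumBelow-cong (suc b) h = cong₂ _+ᶻ_ (h 0 (s≤s z≤n)) (sumBelow-cong b (λ t t<b → h (suc t) (s≤s t<b)))

-- In degree k the hypothesis reads (1 - y) a_t = a_(t+1), so each term y a_t is the difference of
-- two consecutive members.
telescope : ∀ b (a : ℕ → Seq) k → (∀ t → t < b → a t k ≡ a (suc t) k +ᶻ shift (a t) k) →
  a b k +ᶻ sumBelow b (λ t → shift (a t) k) ≡ a 0 k
telescope zero a k h = ℤ.+-identityʳ (a 0 k)
telescope (suc b) a k h = begin
  a (suc b) k +ᶻ (shift (a 0) k +ᶻ rest)
    ≡⟨ solve 3 (λ x y z → x :+ (y :+ z) := (x :+ z) :+ y) refl (a (suc b) k) (shift (a 0) k) rest ⟩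
  (a (suc b) k +ᶻ rest) +ᶻ shift (a 0) k
    ≡⟨ cong (_+ᶻ shift (a 0) k) (telescope b (λ t → a (suc t)) k (λ t t<b → h (suc t) (s≤s t<b))) ⟩
  a 1 k +ᶻ shift (a 0) k ≡⟨ h 0 (s≤s z≤n) ⟨
  a 0 k ∎
  where open ≡-Reasoning
        open ℤSolver.+-*-Solver
        rest : ℤ
        rest = sumBelow b (λ t → shift (a (suc t)) k)

-- Index 0 is exempt from the hypothesis because the slice at 0 belongs to another family. The last
-- summand on the right measures its deviation from the pattern of the others.
psums-telescope : ∀ r b (e : Seq) k (L : ℕ → ℤ) → suc b ≤ r →
  (∀ t → t < b → L (suc t) ≡ shift (psums (r ∸ suc t) e) k) →
  psums (r ∸ suc b) e k +ᶻ sumBelow (suc b) L ≡ psums r e k +ᶻ (L 0 -ᶻ shift (psums r e) k)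
psums-telescope (suc r) b e k L (s≤s b≤r) eq = begin
  a b k +ᶻ (L 0 +ᶻ sumBelow b (λ t → L (suc t)))
    ≡⟨ cong (λ z → a b k +ᶻ (L 0 +ᶻ z)) (sumBelow-cong b eq) ⟩
  a b k +ᶻ (L 0 +ᶻ rest)
    ≡⟨ solve 3 (λ x y z → x :+ (y :+ z) := (x :+ z) :+ y) refl (a b k) (L 0) rest ⟩
  (a b k +ᶻ rest) +ᶻ L 0
    ≡⟨ cong (_+ᶻ L 0) (telescope b a k step) ⟩
  a 0 k +ᶻ L 0
    ≡⟨ solve 3 (λ x y z → x :+ y := (x :+ z) :+ (y :- z)) refl (a 0 k) (L 0) (shift (psums (suc r) e) k) ⟩
  (a 0 k +ᶻ shift (psums (suc r) e) k) +ᶻ (L 0 -ᶻ shift (psums (suc r) e) k)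
    ≡⟨ cong (_+ᶻ (L 0 -ᶻ shift (psums (suc r) e) k)) (psum-step (psums r e) k) ⟨
  psums (suc r) e k +ᶻ (L 0 -ᶻ shift (psums (suc r) e) k) ∎
  where
  open ≡-Reasoning
  open ℤSolver.+-*-Solver
  a : ℕ → Seq
  a t = psums (r ∸ t) e
  rest : ℤ
  rest = sumBelow b (λ t → shift (a t) k)
  step : ∀ t → t < b → a t k ≡ a (suc t) k +ᶻ shift (a t) k
  step t t<b = trans
    (cong (λ s → psums s e k) r∸t)
    (trans (psum-step (psums (r ∸ suc t) e) k)
      (cong (λ s → psums (r ∸ suc t) e k +ᶻ shift (psums s e) k) (sym r∸t)))
    where
    r∸t : r ∸ t ≡ suc (r ∸ suc t)
    r∸t = ℕ.+-∸-assoc 1 (ℕ.<-≤-trans t<b b≤r)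

-- Subsets of Fin (suc n) split at the last element

zipWith-∷ʳ : ∀ {A B C : Set} (g : A → B → C) {n} (xs : Vec A n) (ys : Vec B n) x y →
  zipWith g (xs ∷ʳ x) (ys ∷ʳ y) ≡ zipWith g xs ys ∷ʳ g x y
zipWith-∷ʳ g [] [] x y = refl
zipWith-∷ʳ g (a ∷ xs) (b ∷ ys) x y = cong (g a b ∷_) (zipWith-∷ʳ g xs ys x y)

replicate-∷ʳ : ∀ {A : Set} n (x : A) → replicate n x ∷ʳ x ≡ replicate (suc n) x
replicate-∷ʳ zero x = refl
replicate-∷ʳ (suc n) x = cong (x ∷_) (replicate-∷ʳ n x)

∷ʳ-⊆ : ∀ {n} (A B : Subset n) b → A ⊆ B → A ∷ʳ b ⊆ B ∷ʳ b
∷ʳ-⊆ [] [] b A⊆B = ⊆-refl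
∷ʳ-⊆ (outside ∷ A) (_ ∷ B) b A⊆B = out⊆ (∷ʳ-⊆ A B b (drop-∷-⊆ A⊆B))
∷ʳ-⊆ (inside ∷ A) (c ∷ B) b A⊆B with A⊆B here
... | here = s⊆s (∷ʳ-⊆ A B b (drop-∷-⊆ A⊆B))

∷ʳ-out⊆in : ∀ {n} (A : Subset n) → A ∷ʳ outside ⊆ A ∷ʳ inside
∷ʳ-out⊆in [] = out⊆ ⊆-refl
∷ʳ-out⊆in (a ∷ A) = s⊆s (∷ʳ-out⊆in A)

∣∷ʳ-inside∣ : ∀ {n} (A : Subset n) → ∣ A ∷ʳ inside ∣ ≡ suc ∣ A ∣
∣∷ʳ-inside∣ [] = refl
∣∷ʳ-inside∣ (inside ∷ A) = cong suc (∣∷ʳ-inside∣ A)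
∣∷ʳ-inside∣ (outside ∷ A) = ∣∷ʳ-inside∣ A

∣∷ʳ-outside∣ : ∀ {n} (A : Subset n) → ∣ A ∷ʳ outside ∣ ≡ ∣ A ∣
∣∷ʳ-outside∣ [] = refl
∣∷ʳ-outside∣ (inside ∷ A) = cong suc (∣∷ʳ-outside∣ A)
∣∷ʳ-outside∣ (outside ∷ A) = ∣∷ʳ-outside∣ A

codim : ∀ {n} → Subset n → ℕ
codim {n} A = n ∸ ∣ A ∣

codim-in : ∀ {n} (A : Subset n) → codim (A ∷ʳ inside) ≡ codim A
codim-in {n} A = cong (suc n ∸_) (∣∷ʳ-inside∣ A)

codim-out : ∀ {n} (A : Subset n) → codim (A ∷ʳ outside) ≡ suc (codim A)
codim-out {n} A = trans (cong (suc n ∸_) (∣∷ʳ-outside∣ A)) (ℕ.+-∸-assoc 1 (∣p∣≤n A))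

-- Families of subsets and their maximal members

Family : ℕ → Set
Family n = Subset n → Bool

_↾_ : ∀ {n} → Family (suc n) → Bool → Family n
(N ↾ b) A = N (A ∷ʳ b)

-- Only one-element extensions of A are inspected, which suffices for down-closed N.
maximal : ∀ {n} → Family n → Family n
maximal {zero} N A = N A
maximal {suc n} N A =
  if last A then maximal (N ↾ inside) (init A)
  else maximal (N ↾ outside) (init A) ∧ not (N (init A ∷ʳ inside))

-- count N k is the number of members of codimension k.
count : ∀ {n} → Family n → ℕ → ℕ
count {zero} N zero = if N [] then 1 else 0
count {zero} N (suc k) = 0
count {suc n} N zero = count (N ↾ inside) zero
count {suc n} N (suc k) = count (N ↾ inside) (suc k) + count (N ↾ outside) k

maximal-in : ∀ {n} (N : Family (suc n)) A → maximal N (A ∷ʳ inside) ≡ maximal (N ↾ inside) A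
maximal-in N A rewrite last-∷ʳ inside A | init-∷ʳ inside A = refl

maximal-out : ∀ {n} (N : Family (suc n)) A →
  maximal N (A ∷ʳ outside) ≡ maximal (N ↾ outside) A ∧ not (N (A ∷ʳ inside))
maximal-out N A rewrite last-∷ʳ outside A | init-∷ʳ outside A = refl

maximal-member : ∀ {n} (N : Family n) A → N A ≡ false → maximal N A ≡ false
maximal-member {zero} N A ¬N = ¬N
maximal-member {suc n} N A ¬N with initLast A
... | A′ , inside , refl = maximal-member (N ↾ inside) A′ ¬N
... | A′ , outside , refl =
  cong (_∧ not (N (A′ ∷ʳ inside))) (maximal-member (N ↾ outside) A′ ¬N)

maximal-local : ∀ {n} (N M : Family n) A → (∀ B → A ⊆ B → N B ≡ M B) → maximal N A ≡ maximal M A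
maximal-local {zero} N M A eq = eq A ⊆-refl
maximal-local {suc n} N M A eq with initLast A
... | A′ , inside , refl =
  maximal-local (N ↾ inside) (M ↾ inside) A′ (λ B A⊆B → eq _ (∷ʳ-⊆ A′ B inside A⊆B))
... | A′ , outside , refl = cong₂ (λ a b → a ∧ not b)
  (maximal-local (N ↾ outside) (M ↾ outside) A′ (λ B A⊆B → eq _ (∷ʳ-⊆ A′ B outside A⊆B)))
  (eq _ (∷ʳ-out⊆in A′))

count-cong : ∀ {n} (N M : Family n) k → (∀ A → codim A ≡ k → N A ≡ M A) → count N k ≡ count M k
count-cong {zero} N M zero eq = cong (if_then 1 else 0) (eq [] refl)
count-cong {zero} N M (suc k) eq = refl
count-cong {suc n} N M zero eq =
  count-cong (N ↾ inside) (M ↾ inside) zero (λ A c → eq _ (trans (codim-in A) c))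
count-cong {suc n} N M (suc k) eq = cong₂ _+_
  (count-cong (N ↾ inside) (M ↾ inside) (suc k) (λ A c → eq _ (trans (codim-in A) c)))
  (count-cong (N ↾ outside) (M ↾ outside) k (λ A c → eq _ (trans (codim-out A) (cong suc c))))

count-none : ∀ n k → count {n} (λ _ → false) k ≡ 0
count-none zero zero = refl
count-none zero (suc k) = refl
count-none (suc n) zero = count-none n zero
count-none (suc n) (suc k) = cong₂ _+_ (count-none n (suc k)) (count-none n k)

count-split : ∀ {n} (N M : Family n) k →
  count N k ≡ count (λ A → N A ∧ M A) k + count (λ A → N A ∧ not (M A)) k
count-split {zero} N M zero with N [] | M []
... | false | _ = refl
... | true | false = refl
... | true | true = refl
count-split {zero} N M (suc k) = refl
count-split {suc n} N M zero = count-split (N ↾ inside) (M ↾ inside) zero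
count-split {suc n} N M (suc k) = begin
  count (N ↾ inside) (suc k) + count (N ↾ outside) k
    ≡⟨ cong₂ _+_ (count-split (N ↾ inside) (M ↾ inside) (suc k)) (count-split (N ↾ outside) (M ↾ outside) k) ⟩
  (a + b) + (c + d) ≡⟨ solve 4 (λ a b c d → (a :+ b) :+ (c :+ d) := (a :+ c) :+ (b :+ d)) refl a b c d ⟩
  (a + c) + (b + d) ∎
  where
  open ≡-Reasoning
  open ℕSolver.+-*-Solver
  a b c d : ℕ
  a = count (λ A → N (A ∷ʳ inside) ∧ M (A ∷ʳ inside)) (suc k)
  b = count (λ A → N (A ∷ʳ inside) ∧ not (M (A ∷ʳ inside))) (suc k)
  c = count (λ A → N (A ∷ʳ outside) ∧ M (A ∷ʳ outside)) k
  d = count (λ A → N (A ∷ʳ outside) ∧ not (M (A ∷ʳ outside))) k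

one : ℕ → ℕ
one zero = 1
one (suc _) = 0

count-maximal-of-top : ∀ {n} (N : Family n) → (∀ A → N A ≡ true) → ∀ k → count (maximal N) k ≡ one k
count-maximal-of-top {zero} N all zero rewrite all [] = refl
count-maximal-of-top {zero} N all (suc k) = refl
count-maximal-of-top {suc n} N all zero = trans
  (count-cong _ _ zero (λ A _ → maximal-in N A))
  (count-maximal-of-top (N ↾ inside) (λ A → all _) zero)
count-maximal-of-top {suc n} N all (suc k) = cong₂ _+_
  (trans (count-cong _ _ (suc k) (λ A _ → maximal-in N A))
    (count-maximal-of-top (N ↾ inside) (λ A → all _) (suc k)))
  (trans (count-cong _ _ k (λ A _ → trans (maximal-out N A)
    (trans (cong (λ b → maximal (N ↾ outside) A ∧ not b) (all _)) (Bool.∧-zeroʳ _))))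
    (count-none n k))

-- 1 - Σ y^(codim A) over the maximal members A of N.
series : ∀ {n} → Family n → Seq
series N k = + one k -ᶻ + count (maximal N) k

-- Supersets of a set of codimension k have codimension at most k, so families that agree only in
-- low codimension still share their low coefficients.
series-local : ∀ {n} (N M : Family n) k → (∀ A → codim A ≡ k → ∀ B → A ⊆ B → N B ≡ M B) →
  series N k ≡ series M k
series-local N M k eq = cong (λ c → + one k -ᶻ + c)
  (count-cong (maximal N) (maximal M) k (λ A c → maximal-local N M A (eq A c)))

-- The full set is the only maximal member, and its term y^0 cancels the 1. This covers the family
-- that belongs to an empty slice.
series-of-top : ∀ {n} (N : Family n) → (∀ A → N A ≡ true) → ∀ k → series N k ≡ 0ℤ
series-of-top N all k rewrite count-maximal-of-top N all k = ℤ.+-inverseʳ (+ one k)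

-- In the relevant codimensions the hypothesis makes the maximal members of N ↾ inside
-- exactly those maximal members of N ↾ outside that lie in N ↾ inside.
series-rec : ∀ {n} m (N : Family (suc n)) →
  (∀ A → suc (codim A) < m → N (A ∷ʳ inside) ≡ true →
    ∀ B → A ⊆ B → N (B ∷ʳ outside) ≡ N (B ∷ʳ inside)) →
  ∀ k → k < m →
  series N k ≡ series (N ↾ inside) k +ᶻ (shift (series (N ↾ outside)) k -ᶻ shift (series (N ↾ inside)) k)
series-rec {n} m N agree zero k<m = trans
  (cong (λ c → + 1 -ᶻ + c) (count-cong _ _ zero (λ A _ → maximal-in N A)))
  (sym (ℤ.+-identityʳ _))
series-rec {n} m N agree (suc k) k<m = begin
  0ℤ -ᶻ + (count (maximal N ↾ inside) (suc k) + count (maximal N ↾ outside) k)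
    ≡⟨ cong₂ (λ a b → 0ℤ -ᶻ + (a + b))
         (count-cong _ _ (suc k) (λ A _ → maximal-in N A))
         (count-cong _ _ k (λ A _ → maximal-out N A)) ⟩
  0ℤ -ᶻ + (c₁′ + d)
    ≡⟨ cong (λ z → 0ℤ -ᶻ z) (ℤ.pos-+ c₁′ d) ⟩
  0ℤ -ᶻ (+ c₁′ +ᶻ + d)
    ≡⟨ solve 4 (λ e a b c → con 0ℤ :- (a :+ b) := (con 0ℤ :- a) :+ ((e :- (c :+ b)) :- (e :- c)))
         refl (+ one k) (+ c₁′) (+ d) (+ c₁) ⟩
  (0ℤ -ᶻ + c₁′) +ᶻ ((+ one k -ᶻ (+ c₁ +ᶻ + d)) -ᶻ (+ one k -ᶻ + c₁))
    ≡⟨ cong (λ z → (0ℤ -ᶻ + c₁′) +ᶻ ((+ one k -ᶻ z) -ᶻ (+ one k -ᶻ + c₁)))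
         (trans (sym (ℤ.pos-+ c₁ d)) (cong +_ (sym c₀-split))) ⟩
  (0ℤ -ᶻ + c₁′) +ᶻ ((+ one k -ᶻ + c₀) -ᶻ (+ one k -ᶻ + c₁)) ∎
  where
  open ≡-Reasoning
  open ℤSolver.+-*-Solver
  c₁′ c₁ c₀ d : ℕ
  c₁′ = count (maximal (N ↾ inside)) (suc k)
  c₁ = count (maximal (N ↾ inside)) k
  c₀ = count (maximal (N ↾ outside)) k
  d = count (λ A → maximal (N ↾ outside) A ∧ not (N (A ∷ʳ inside))) k
  same : ∀ A → codim A ≡ k → maximal (N ↾ outside) A ∧ N (A ∷ʳ inside) ≡ maximal (N ↾ inside) A
  same A c with N (A ∷ʳ inside) in eq
  ... | true = trans (Bool.∧-identityʳ _)
    (maximal-local (N ↾ outside) (N ↾ inside) A (agree A (subst (λ j → suc j < m) (sym c) k<m) eq))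
  ... | false = trans (Bool.∧-zeroʳ _) (sym (maximal-member (N ↾ inside) A eq))
  c₀-split : c₀ ≡ c₁ + d
  c₀-split = trans (count-split (maximal (N ↾ outside)) (N ↾ inside) k)
    (cong (_+ d) (count-cong _ _ k same))

-- The rank function of the slice of a polymatroid on which the last coordinate is x.
slice : ∀ {n} → (Subset (suc n) → ℕ) → ℕ → Subset n → ℕ
slice f x A = f (A ∷ʳ outside) ⊓ (f (A ∷ʳ inside) ∸ x)

lastMax : ∀ {n} → (Subset (suc n) → ℕ) → ℕ
lastMax f = f (⊥ ∷ʳ inside)

module Split {n} (f : Subset (suc n) → ℕ) (rank : IsRankFunction (suc n) f) where
  open IsRankFunction rank

  mono : ∀ {A B : Subset n} b → A ⊆ B → f (A ∷ʳ b) ≤ f (B ∷ʳ b)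
  mono {A} {B} b A⊆B = monotone _ _ (∷ʳ-⊆ A B b A⊆B)

  out≤in : ∀ (A : Subset n) → f (A ∷ʳ outside) ≤ f (A ∷ʳ inside)
  out≤in A = monotone _ _ (∷ʳ-out⊆in A)

  submod : ∀ (A B : Subset n) a b →
    f ((A ∪ B) ∷ʳ (a ∨ b)) + f ((A ∩ B) ∷ʳ (a ∧ b)) ≤ f (A ∷ʳ a) + f (B ∷ʳ b)
  submod A B a b = subst₂ (λ U V → f U + f V ≤ f (A ∷ʳ a) + f (B ∷ʳ b))
    (zipWith-∷ʳ _∨_ A B a b) (zipWith-∷ʳ _∧_ A B a b) (submodular (A ∷ʳ a) (B ∷ʳ b))

  ⊤-in : f (⊤ ∷ʳ inside) ≡ f ⊤
  ⊤-in = cong f (replicate-∷ʳ n inside)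

  ⊥-out : f (⊥ ∷ʳ outside) ≡ 0
  ⊥-out = trans (cong f (replicate-∷ʳ n outside)) f-empty

  lastMax≤ : ∀ A → lastMax f ≤ f (A ∷ʳ inside)
  lastMax≤ A = mono inside (⊆-min A)

  in≤⊤ : ∀ A → f (A ∷ʳ inside) ≤ f ⊤
  in≤⊤ A = subst (f (A ∷ʳ inside) ≤_) ⊤-in (mono inside (⊆-max A))

  lastMax≤⊤ : lastMax f ≤ f ⊤
  lastMax≤⊤ = in≤⊤ ⊥

  in≤out+lastMax : ∀ A → f (A ∷ʳ inside) ≤ f (A ∷ʳ outside) + lastMax f
  in≤out+lastMax A = ℕ.≤-trans (ℕ.m≤m+n _ _)
    (subst (λ U → f (U ∷ʳ inside) + f ((A ∩ ⊥) ∷ʳ outside) ≤ f (A ∷ʳ outside) + lastMax f)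
      (∪-identityʳ A) (submod A ⊥ outside inside))

  slice≤out : ∀ x A → slice f x A ≤ f (A ∷ʳ outside)
  slice≤out x A = ℕ.m⊓n≤m _ _

  slice≤in : ∀ x A → slice f x A ≤ f (A ∷ʳ inside) ∸ x
  slice≤in x A = ℕ.m⊓n≤n (f (A ∷ʳ outside)) _

  -- A minimum of two submodular functions need not be submodular. The mixed case works here because
  -- submodularity of `f` at a set without and a set with the last element bounds the union with it
  -- and the intersection without it. The bound on `x` keeps the subtractions exact.
  slice-isRankFunction : ∀ {x} → x ≤ lastMax f → IsRankFunction n (slice f x)
  slice-isRankFunction {x} x≤ = record
    { f-empty = cong (_⊓ (f (⊥ ∷ʳ inside) ∸ x)) ⊥-out
    ; monotone = λ A B A⊆B → ℕ.⊓-mono-≤ (mono outside A⊆B) (ℕ.∸-monoˡ-≤ x (mono inside A⊆B))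
    ; submodular = sub
    }
    where
    x≤in : ∀ A → x ≤ f (A ∷ʳ inside)
    x≤in A = ℕ.≤-trans x≤ (lastMax≤ A)
    move : ∀ {p q r s} → x ≤ p → x ≤ s → p + q ≤ r + s → (p ∸ x) + q ≤ r + (s ∸ x)
    move {p} {q} {r} {s} x≤p x≤s h =
      subst₂ _≤_ (ℕ.+-∸-comm q x≤p) (ℕ.+-∸-assoc r x≤s) (ℕ.∸-monoˡ-≤ x h)
    sub : ∀ A B → slice f x (A ∪ B) + slice f x (A ∩ B) ≤ slice f x A + slice f x B
    sub A B with ℕ.⊓-sel (f (A ∷ʳ outside)) (f (A ∷ʳ inside) ∸ x)
               | ℕ.⊓-sel (f (B ∷ʳ outside)) (f (B ∷ʳ inside) ∸ x)
    ... | inj₁ eA | inj₁ eB rewrite eA | eB = ℕ.≤-trans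
      (ℕ.+-mono-≤ (slice≤out x (A ∪ B)) (slice≤out x (A ∩ B))) (submod A B outside outside)
    ... | inj₁ eA | inj₂ eB rewrite eA | eB = ℕ.≤-trans
      (ℕ.+-mono-≤ (slice≤in x (A ∪ B)) (slice≤out x (A ∩ B)))
      (move (x≤in (A ∪ B)) (x≤in B) (submod A B outside inside))
    ... | inj₂ eA | inj₁ eB rewrite eA | eB = ℕ.≤-trans
      (ℕ.+-mono-≤ (slice≤in x (A ∪ B)) (slice≤out x (A ∩ B)))
      (subst ((f ((A ∪ B) ∷ʳ inside) ∸ x) + f ((A ∩ B) ∷ʳ outside) ≤_) (ℕ.+-comm (f (B ∷ʳ outside)) _)
        (move (x≤in (A ∪ B)) (x≤in A)
          (subst (f ((A ∪ B) ∷ʳ inside) + f ((A ∩ B) ∷ʳ outside) ≤_) (ℕ.+-comm (f (A ∷ʳ inside)) _)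
            (submod A B inside outside))))
    ... | inj₂ eA | inj₂ eB rewrite eA | eB = ℕ.≤-trans
      (ℕ.+-mono-≤ (slice≤in x (A ∪ B)) (slice≤in x (A ∩ B)))
      (subst₂ _≤_ (twice (A ∪ B) (A ∩ B)) (twice A B)
        (ℕ.∸-monoˡ-≤ x (ℕ.∸-monoˡ-≤ x (submod A B inside inside))))
      where
      twice : ∀ A B → (f (A ∷ʳ inside) + f (B ∷ʳ inside)) ∸ x ∸ x
                    ≡ (f (A ∷ʳ inside) ∸ x) + (f (B ∷ʳ inside) ∸ x)
      twice A B = trans (cong (_∸ x) (ℕ.+-∸-comm (f (B ∷ʳ inside)) (x≤in A)))
                        (ℕ.+-∸-assoc (f (A ∷ʳ inside) ∸ x) (x≤in B))

  -- The hypothesis holds when the slice is nonempty. Without it the minimum at `⊤` would fall below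
  -- r - x, and `slice f x` would describe a different polymatroid.
  slice-⊤ : ∀ x → f ⊤ ∸ x ≤ f (⊤ ∷ʳ outside) → slice f x ⊤ ≡ f ⊤ ∸ x
  slice-⊤ x r-x≤ = trans (cong (λ r → f (⊤ ∷ʳ outside) ⊓ (r ∸ x)) ⊤-in) (ℕ.m≥n⇒m⊓n≡n r-x≤)

≡true-ext : ∀ {a b : Bool} → (a ≡ true → b ≡ true) → (b ≡ true → a ≡ true) → a ≡ b
≡true-ext f g = Bool.⇔→≡ {z = true} (mk⇔ f g)

<ᵇ⇒< : ∀ a b → (a <ᵇ b) ≡ true → a < b
<ᵇ⇒< a b eq = ℕ.<ᵇ⇒< a b (Equivalence.from Bool.T-≡ eq)

<⇒<ᵇ : ∀ a b → a < b → (a <ᵇ b) ≡ true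
<⇒<ᵇ a b a<b = Equivalence.to Bool.T-≡ (ℕ.<⇒<ᵇ a<b)

-- Non-spanning sets of a polymatroid and of its slices

nonspanning : ∀ {n} → (Subset n → ℕ) → Family n
nonspanning f A = f A <ᵇ f ⊤

-- This stands in for the bound by `r₂ f`: with `m` left free, the condition passes to slices, where
-- `m` may shrink.
NearlySpanning : ∀ {n} → ℕ → (Subset n → ℕ) → Set
NearlySpanning m f = ∀ A → codim A < m → f ⊤ ≤ suc (f A)

module Slices {n} (f : Subset (suc n) → ℕ) (rank : IsRankFunction (suc n) f)
              (m : ℕ) (near : NearlySpanning m f) where
  open Split f rank

  N : Family (suc n)
  N = nonspanning f

  near-out : ∀ A → suc (codim A) < m → f ⊤ ≤ suc (f (A ∷ʳ outside))
  near-out A c = near _ (subst (_< m) (sym (codim-out A)) c)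

  near-in : ∀ A → codim A < m → f ⊤ ≤ suc (f (A ∷ʳ inside))
  near-in A c = near _ (subst (_< m) (sym (codim-in A)) c)

  -- Two non-spanning sets of rank f ⊤ - 1 whose intersection has rank f ⊤ - 1
  -- have a non-spanning union, so A lies in at most one maximal non-spanning set.
  agree : ∀ A → suc (codim A) < m → N (A ∷ʳ inside) ≡ true →
    ∀ B → A ⊆ B → N (B ∷ʳ outside) ≡ N (B ∷ʳ inside)
  agree A c NA B A⊆B = ≡true-ext up (λ NB → <⇒<ᵇ _ (f ⊤) (ℕ.≤-<-trans (out≤in B) (<ᵇ⇒< _ (f ⊤) NB)))
    where
    up : N (B ∷ʳ outside) ≡ true → N (B ∷ʳ inside) ≡ true
    up NB = <⇒<ᵇ _ (f ⊤) (ℕ.+-cancelʳ-< (f (A ∷ʳ outside)) _ _ (begin-strict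
      f (B ∷ʳ inside) + f (A ∷ʳ outside)
        ≤⟨ ℕ.+-mono-≤ (mono inside B⊆) (mono outside ⊆A∩B) ⟩
      f ((A ∪ B) ∷ʳ inside) + f ((A ∩ B) ∷ʳ outside)
        ≤⟨ submod A B inside outside ⟩
      f (A ∷ʳ inside) + f (B ∷ʳ outside)
        <⟨ ℕ.+-mono-<-≤ (<ᵇ⇒< _ (f ⊤) NA) (ℕ.≤-pred (ℕ.≤-trans (<ᵇ⇒< _ (f ⊤) NB) (near-out A c))) ⟩
      f ⊤ + f (A ∷ʳ outside) ∎))
      where
      open ℕ.≤-Reasoning
      B⊆ : B ⊆ A ∪ B
      B⊆ = q⊆p∪q A B
      ⊆A∩B : A ⊆ A ∩ B
      ⊆A∩B x∈A = x∈p∩q⁺ (x∈A , A⊆B x∈A)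

  module _ {x} (x≤ : x ≤ lastMax f) (r-x≤ : f ⊤ ∸ x ≤ f (⊤ ∷ʳ outside)) where

    slice-nonspanning-in : ∀ A → f (A ∷ʳ inside) < f ⊤ → slice f x A < slice f x ⊤
    slice-nonspanning-in A lt = subst (slice f x A <_) (sym (slice-⊤ x r-x≤))
      (ℕ.≤-<-trans (slice≤in x A)
        (ℕ.∸-monoˡ-< lt (ℕ.≤-trans x≤ (lastMax≤ A))))

    slice-nonspanning-cases : ∀ A → slice f x A < slice f x ⊤ →
      f (A ∷ʳ outside) < f ⊤ ∸ x ⊎ f (A ∷ʳ inside) < f ⊤
    slice-nonspanning-cases A lt with ℕ.⊓-sel (f (A ∷ʳ outside)) (f (A ∷ʳ inside) ∸ x)
    ... | inj₁ e = inj₁ (subst₂ _<_ e (slice-⊤ x r-x≤) lt)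
    ... | inj₂ e = inj₂ (ℕ.≰⇒> λ r≤ → ℕ.<⇒≱ (subst₂ _<_ e (slice-⊤ x r-x≤) lt) (ℕ.∸-monoˡ-≤ x r≤))

    -- The inside branch of the minimum is below r - x exactly when `f (A ∷ʳ inside)` is below r,
    -- independently of x; the hypothesis disposes of the outside branch.
    slice-nonspanning : ∀ A → (f (A ∷ʳ outside) < f ⊤ ∸ x → f (A ∷ʳ inside) < f ⊤) →
      nonspanning (slice f x) A ≡ N (A ∷ʳ inside)
    slice-nonspanning A h = ≡true-ext fwd (λ e → <⇒<ᵇ _ (slice f x ⊤) (slice-nonspanning-in A (<ᵇ⇒< _ (f ⊤) e)))
      where
      fwd : nonspanning (slice f x) A ≡ true → N (A ∷ʳ inside) ≡ true
      fwd e with slice-nonspanning-cases A (<ᵇ⇒< _ (slice f x ⊤) e)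
      ... | inj₁ lt = <⇒<ᵇ _ (f ⊤) (h lt)
      ... | inj₂ lt = <⇒<ᵇ _ (f ⊤) lt

∧-true : ∀ {a b} → a ∧ b ≡ true → a ≡ true × b ≡ true
∧-true {true} {true} _ = refl , refl

-- Membership and activity as propositions

allᵇ-pairs : ∀ {n} (p : Subset (suc n) → Bool) xs →
  allᵇ p (concatMap (λ A → (inside ∷ A) ∷ₗ ((outside ∷ A) ∷ₗ []ₗ)) xs)
  ≡ allᵇ (λ A → p (inside ∷ A) ∧ p (outside ∷ A)) xs
allᵇ-pairs p []ₗ = refl
allᵇ-pairs p (A ∷ₗ xs) = trans (sym (Bool.∧-assoc (p (inside ∷ A)) (p (outside ∷ A)) _))
  (cong ((p (inside ∷ A) ∧ p (outside ∷ A)) ∧_) (allᵇ-pairs p xs))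

allᵇ-subsets : ∀ {n} (p : Subset n → Bool) → allᵇ p (allSubsets n) ≡ true → ∀ A → p A ≡ true
allᵇ-subsets {zero} p eq [] = proj₁ (∧-true eq)
allᵇ-subsets {suc n} p eq (b ∷ A) = pick b
  where
  both : p (inside ∷ A) ≡ true × p (outside ∷ A) ≡ true
  both = ∧-true (allᵇ-subsets (λ A → p (inside ∷ A) ∧ p (outside ∷ A))
    (trans (sym (allᵇ-pairs p (allSubsets n))) eq) A)
  pick : ∀ b → p (b ∷ A) ≡ true
  pick inside = proj₁ both
  pick outside = proj₂ both

allᵇ-subsets⁻¹ : ∀ {n} (p : Subset n → Bool) → (∀ A → p A ≡ true) → allᵇ p (allSubsets n) ≡ true
allᵇ-subsets⁻¹ {zero} p all rewrite all [] = refl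
allᵇ-subsets⁻¹ {suc n} p all = trans (allᵇ-pairs p (allSubsets n))
  (allᵇ-subsets⁻¹ (λ A → p (inside ∷ A) ∧ p (outside ∷ A)) (λ A → cong₂ _∧_ (all _) (all _)))

allᵇ-tabulate : ∀ {A : Set} {n} (p : A → Bool) (g : Fin n → A) →
  allᵇ p (tabulateₗ g) ≡ true → ∀ i → p (g i) ≡ true
allᵇ-tabulate p g eq zero = proj₁ (∧-true eq)
allᵇ-tabulate p g eq (suc i) = allᵇ-tabulate p (g ∘ suc) (proj₂ (∧-true eq)) i

allᵇ-tabulate⁻¹ : ∀ {A : Set} {n} (p : A → Bool) (g : Fin n → A) →
  (∀ i → p (g i) ≡ true) → allᵇ p (tabulateₗ g) ≡ true
allᵇ-tabulate⁻¹ {n = zero} p g all = refl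
allᵇ-tabulate⁻¹ {n = suc n} p g all = cong₂ _∧_ (all zero) (allᵇ-tabulate⁻¹ p (g ∘ suc) (all ∘ suc))

_∈P_ : ∀ {n} → Vec ℕ n → (Subset n → ℕ) → Set
a ∈P f = (∀ A → sumOver A a ≤ f A) × total a ≡ f ⊤

inP⇒∈P : ∀ {n} (f : Subset n → ℕ) a → inP f a ≡ true → a ∈P f
inP⇒∈P f a eq with ∧-true eq
... | e₁ , e₂ = (λ A → ℕ.≤ᵇ⇒≤ _ _ (Equivalence.from Bool.T-≡ (allᵇ-subsets _ e₁ A))) , ℕ.≡ᵇ⇒≡ _ _ (Equivalence.from Bool.T-≡ e₂)

∈P⇒inP : ∀ {n} (f : Subset n → ℕ) a → a ∈P f → inP f a ≡ true
∈P⇒inP f a (le , eq) = cong₂ _∧_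
  (allᵇ-subsets⁻¹ _ (λ A → Equivalence.to Bool.T-≡ (ℕ.≤⇒≤ᵇ (le A)))) (Equivalence.to Bool.T-≡ (ℕ.≡⇒≡ᵇ _ _ eq))

inP-cong : ∀ {n k} (f : Subset n → ℕ) a (g : Subset k → ℕ) b →
  (a ∈P f → b ∈P g) → (b ∈P g → a ∈P f) → inP f a ≡ inP g b
inP-cong f a g b to from = ≡true-ext
  (λ e → ∈P⇒inP g b (to (inP⇒∈P f a e))) (λ e → ∈P⇒inP f a (from (inP⇒∈P g b e)))

-- Both activities unfold to this form.
none : ∀ {n} → Fin n → (Fin n → Bool) → Bool
none {n} i p = allᵇ (λ j → if toℕ j <ᵇ toℕ i then (if p j then false else true) else true) (allFin n)

none⁺ : ∀ {n} (i : Fin n) p → (∀ j → toℕ j < toℕ i → p j ≡ false) → none i p ≡ true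
none⁺ i p h = allᵇ-tabulate⁻¹ _ id step
  where
  step : ∀ j → (if toℕ j <ᵇ toℕ i then (if p j then false else true) else true) ≡ true
  step j with toℕ j <ᵇ toℕ i in lt
  ... | false = refl
  ... | true rewrite h j (<ᵇ⇒< _ _ lt) = refl

none⁻ : ∀ {n} (i : Fin n) p → none i p ≡ true → ∀ j → toℕ j < toℕ i → p j ≡ false
none⁻ i p eq j lt with allᵇ-tabulate (λ j → if toℕ j <ᵇ toℕ i then (if p j then false else true) else true) id eq j
... | e rewrite <⇒<ᵇ _ (toℕ i) lt with p j
...   | false = refl
...   | true with () ← e

none-cong : ∀ {n k} (i : Fin n) p (i′ : Fin k) q →
  (none i p ≡ true → ∀ j → toℕ j < toℕ i′ → q j ≡ false) →
  (none i′ q ≡ true → ∀ j → toℕ j < toℕ i → p j ≡ false) → none i p ≡ none i′ q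
none-cong i p i′ q to from = ≡true-ext (λ e → none⁺ i′ q (to e)) (λ e → none⁺ i p (from e))

-- Vectors split at the last coordinate

lookup-inject₁ : ∀ {A : Set} {n} (v : Vec A n) x i → lookup (v ∷ʳ x) (inject₁ i) ≡ lookup v i
lookup-inject₁ (y ∷ v) x zero = refl
lookup-inject₁ (y ∷ v) x (suc i) = lookup-inject₁ v x i

updateAt-inject₁ : ∀ {A : Set} {n} (v : Vec A n) x i (g : A → A) →
  updateAt (v ∷ʳ x) (inject₁ i) g ≡ updateAt v i g ∷ʳ x
updateAt-inject₁ (y ∷ v) x zero g = refl
updateAt-inject₁ (y ∷ v) x (suc i) g = cong (y ∷_) (updateAt-inject₁ v x i g)

updateAt-fromℕ : ∀ {A : Set} {n} (v : Vec A n) x (g : A → A) →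
  updateAt (v ∷ʳ x) (fromℕ n) g ≡ v ∷ʳ g x
updateAt-fromℕ [] x g = refl
updateAt-fromℕ (y ∷ v) x g = cong (y ∷_) (updateAt-fromℕ v x g)

tabulate-∷ʳ : ∀ {A : Set} n (g : Fin (suc n) → A) → tabulate g ≡ tabulate (g ∘ inject₁) ∷ʳ g (fromℕ n)
tabulate-∷ʳ zero g = refl
tabulate-∷ʳ (suc n) g = cong (g zero ∷_) (tabulate-∷ʳ n (g ∘ suc))

sumOver-∷ʳ : ∀ {n} (A : Subset n) v b x → sumOver (A ∷ʳ b) (v ∷ʳ x) ≡ sumOver A v + (if b then x else 0)
sumOver-∷ʳ [] [] b x = ℕ.+-identityʳ _
sumOver-∷ʳ (c ∷ A) (y ∷ v) b x = trans (cong (_+_ (if c then y else 0)) (sumOver-∷ʳ A v b x))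
  (sym (ℕ.+-assoc (if c then y else 0) (sumOver A v) _))

sumOver-in : ∀ {n} (A : Subset n) v x → sumOver (A ∷ʳ inside) (v ∷ʳ x) ≡ sumOver A v + x
sumOver-in A v x = sumOver-∷ʳ A v inside x

sumOver-out : ∀ {n} (A : Subset n) v x → sumOver (A ∷ʳ outside) (v ∷ʳ x) ≡ sumOver A v
sumOver-out A v x = trans (sumOver-∷ʳ A v outside x) (ℕ.+-identityʳ _)

sumOver-⊥ : ∀ {n} (v : Vec ℕ n) → sumOver ⊥ v ≡ 0
sumOver-⊥ [] = refl
sumOver-⊥ (x ∷ v) = sumOver-⊥ v

sumOver-modular : ∀ {n} (A B : Subset n) v →
  sumOver (A ∪ B) v + sumOver (A ∩ B) v ≡ sumOver A v + sumOver B v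
sumOver-modular [] [] [] = refl
sumOver-modular (a ∷ A) (b ∷ B) (x ∷ v) = begin
  (∪x + sumOver (A ∪ B) v) + (∩x + sumOver (A ∩ B) v) ≡⟨ swap ∪x _ ∩x _ ⟩
  (∪x + ∩x) + (sumOver (A ∪ B) v + sumOver (A ∩ B) v) ≡⟨ cong₂ _+_ (head a b) (sumOver-modular A B v) ⟩
  (ax + bx) + (sumOver A v + sumOver B v) ≡⟨ swap ax bx _ _ ⟩
  (ax + sumOver A v) + (bx + sumOver B v) ∎
  where
  open ≡-Reasoning
  ∪x ∩x ax bx : ℕ
  ∪x = if a ∨ b then x else 0
  ∩x = if a ∧ b then x else 0
  ax = if a then x else 0
  bx = if b then x else 0
  swap : ∀ p q r s → (p + q) + (r + s) ≡ (p + r) + (q + s)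
  swap = solve 4 (λ p q r s → (p :+ q) :+ (r :+ s) := (p :+ r) :+ (q :+ s)) refl
    where open ℕSolver.+-*-Solver
  head : ∀ a b → (if a ∨ b then x else 0) + (if a ∧ b then x else 0) ≡ (if a then x else 0) + (if b then x else 0)
  head false b = ℕ.+-identityʳ _
  head true false = refl
  head true true = refl

sumOver-null : ∀ {n} (A : Subset n) v → (∀ i → lookup A i ≡ true → lookup v i ≡ 0) → sumOver A v ≡ 0
sumOver-null [] [] h = refl
sumOver-null (false ∷ A) (x ∷ v) h = sumOver-null A v (h ∘ suc)
sumOver-null (true ∷ A) (x ∷ v) h rewrite h zero refl = sumOver-null A v (h ∘ suc)

sumOver-decrement : ∀ {n} (A : Subset n) v i {w} → lookup v i ≡ suc w →
  sumOver A (updateAt v i (_∸ 1)) + (if lookup A i then 1 else 0) ≡ sumOver A v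
sumOver-decrement (false ∷ A) (x ∷ v) zero refl = ℕ.+-identityʳ _
sumOver-decrement (true ∷ A) (suc x ∷ v) zero refl =
  trans (ℕ.+-assoc x _ 1) (trans (cong (_+_ x) (ℕ.+-comm _ 1)) (ℕ.+-suc x _))
sumOver-decrement (b ∷ A) (x ∷ v) (suc i) eq =
  trans (ℕ.+-assoc (if b then x else 0) _ _) (cong (_+_ (if b then x else 0)) (sumOver-decrement A v i eq))

minusPlus-zero : ∀ {n} (a : Vec ℕ n) i j → lookup a i ≡ 0 → minusPlus a i j ≡ nothing
minusPlus-zero a i j eq with lookup a i | eq
... | zero | refl = refl

minusPlus-suc : ∀ {n} (a : Vec ℕ n) i j {w} → lookup a i ≡ suc w →
  minusPlus a i j ≡ just (updateAt (updateAt a i (_∸ 1)) j suc)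
minusPlus-suc a i j eq with lookup a i | eq
... | suc w | refl = refl

-- The slice with last coordinate x

module Slice {n} (f : Subset (suc n) → ℕ) (rank : IsRankFunction (suc n) f) where
  open IsRankFunction rank
  open Split f rank

  module _ {x v} (v∷ʳx∈P : (v ∷ʳ x) ∈P f) where

    in-bound : ∀ A → sumOver A v + x ≤ f (A ∷ʳ inside)
    in-bound A = subst (_≤ _) (sumOver-in A v x) (proj₁ v∷ʳx∈P (A ∷ʳ inside))

    out-bound : ∀ A → sumOver A v ≤ f (A ∷ʳ outside)
    out-bound A = subst (_≤ _) (sumOver-out A v x) (proj₁ v∷ʳx∈P (A ∷ʳ outside))

    total-eq : total v + x ≡ f ⊤
    total-eq = trans (sym (sumOver-in ⊤ v x))
      (trans (cong (λ A → sumOver A (v ∷ʳ x)) (replicate-∷ʳ n inside)) (proj₂ v∷ʳx∈P))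

    x≤lastMax : x ≤ lastMax f
    x≤lastMax = subst (_≤ lastMax f) (cong (_+ x) (sumOver-⊥ v)) (in-bound ⊥)

    r-x≤⊤out : f ⊤ ∸ x ≤ f (⊤ ∷ʳ outside)
    r-x≤⊤out = subst (_≤ f (⊤ ∷ʳ outside))
      (trans (sym (ℕ.m+n∸n≡m (total v) x)) (cong (_∸ x) total-eq)) (out-bound ⊤)

  module _ {x} (x≤ : x ≤ lastMax f) (r-x≤ : f ⊤ ∸ x ≤ f (⊤ ∷ʳ outside)) where

    inP-slice : ∀ v → inP f (v ∷ʳ x) ≡ inP (slice f x) v
    inP-slice v = inP-cong f (v ∷ʳ x) (slice f x) v to from
      where
      to : (v ∷ʳ x) ∈P f → v ∈P slice f x
      to p = (λ A → ℕ.⊓-glb (out-bound p A) (ℕ.m+n≤o⇒m≤o∸n (sumOver A v) (in-bound p A)))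
           , trans (sym (ℕ.m+n∸n≡m (total v) x)) (trans (cong (_∸ x) (total-eq p)) (sym (slice-⊤ x r-x≤)))
      from : v ∈P slice f x → (v ∷ʳ x) ∈P f
      from (le , tot) = bound , (begin
        sumOver ⊤ (v ∷ʳ x)               ≡⟨ cong (λ A → sumOver A (v ∷ʳ x)) (replicate-∷ʳ n inside) ⟨
        sumOver (⊤ ∷ʳ inside) (v ∷ʳ x)   ≡⟨ sumOver-in ⊤ v x ⟩
        total v + x                      ≡⟨ cong (_+ x) (trans tot (slice-⊤ x r-x≤)) ⟩
        f ⊤ ∸ x + x                      ≡⟨ ℕ.m∸n+n≡m (ℕ.≤-trans x≤ lastMax≤⊤) ⟩
        f ⊤                              ∎)
        where
        open ≡-Reasoning
        bound : ∀ A → sumOver A (v ∷ʳ x) ≤ f A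
        bound A with initLast A
        ... | A′ , outside , refl = subst (_≤ f (A′ ∷ʳ outside)) (sym (sumOver-out A′ v x))
          (ℕ.≤-trans (le A′) (slice≤out x A′))
        ... | A′ , inside , refl = subst (_≤ f (A′ ∷ʳ inside)) (sym (sumOver-in A′ v x))
          (ℕ.m≤o∸n⇒m+n≤o _ (ℕ.≤-trans x≤ (lastMax≤ A′)) (ℕ.≤-trans (le A′) (slice≤in x A′)))

    inP?-slice : ∀ v i j →
      inP? f (minusPlus (v ∷ʳ x) (inject₁ i) (inject₁ j)) ≡ inP? (slice f x) (minusPlus v i j)
    inP?-slice v i j with lookup v i in eq
    ... | zero = cong (inP? f) (minusPlus-zero (v ∷ʳ x) (inject₁ i) (inject₁ j) (trans (lookup-inject₁ v x i) eq))
    ... | suc w = trans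
      (cong (inP? f) (trans
        (minusPlus-suc (v ∷ʳ x) (inject₁ i) (inject₁ j) (trans (lookup-inject₁ v x i) eq))
        (cong just (trans (cong (λ a → updateAt a (inject₁ j) suc) (updateAt-inject₁ v x i (_∸ 1)))
          (updateAt-inject₁ (updateAt v i (_∸ 1)) x j suc)))))
      (inP-slice _)

    extActive-slice : ∀ v i → extActive f (v ∷ʳ x) (inject₁ i) ≡ extActive (slice f x) v i
    extActive-slice v i = none-cong (inject₁ i) (λ j → inP? f (minusPlus (v ∷ʳ x) j (inject₁ i)))
                                    i (λ j → inP? (slice f x) (minusPlus v j i)) to from
      where
      to : none (inject₁ i) (λ j → inP? f (minusPlus (v ∷ʳ x) j (inject₁ i))) ≡ true →
        ∀ j → toℕ j < toℕ i → inP? (slice f x) (minusPlus v j i) ≡ false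
      to e j lt = trans (sym (inP?-slice v j i))
        (none⁻ _ _ e (inject₁ j) (subst₂ _<_ (sym (Fin.toℕ-inject₁ j)) (sym (Fin.toℕ-inject₁ i)) lt))
      from : none i (λ j → inP? (slice f x) (minusPlus v j i)) ≡ true →
        ∀ j → toℕ j < toℕ (inject₁ i) → inP? f (minusPlus (v ∷ʳ x) j (inject₁ i)) ≡ false
      from e j lt with view j
      ... | ‵fromℕ = ⊥-elim (ℕ.<-asym lt (subst₂ _<_ (sym (Fin.toℕ-inject₁ i)) (sym (Fin.toℕ-fromℕ n)) (Fin.toℕ<n i)))
      ... | ‵inject₁ j′ = trans (inP?-slice v j′ i)
        (none⁻ _ _ e j′ (subst₂ _<_ (Fin.toℕ-inject₁ j′) (Fin.toℕ-inject₁ i) lt))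

    Ext-slice : ∀ v → Ext f (v ∷ʳ x) ≡ Ext (slice f x) v ∷ʳ extActive f (v ∷ʳ x) (fromℕ n)
    Ext-slice v = trans (tabulate-∷ʳ n (extActive f (v ∷ʳ x)))
      (cong (_∷ʳ extActive f (v ∷ʳ x) (fromℕ n)) (tabulate-cong (extActive-slice v)))

  -- The last index is active exactly when the last coordinate is maximal: if no exchange
  -- into it is possible, the intersection of the tight sets blocking the exchanges is
  -- tight and carries only the last coordinate.
  module _ {x v} (p : (v ∷ʳ x) ∈P f) where

    Tight : Subset n → Set
    Tight A = sumOver A v + x ≡ f (A ∷ʳ inside)

    tight-∩ : ∀ {A B} → Tight A → Tight B → Tight (A ∩ B)
    tight-∩ {A} {B} tA tB = ℕ.≤-antisym (in-bound p (A ∩ B))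
      (ℕ.+-cancelˡ-≤ (sumOver (A ∪ B) v + x) _ _ (begin
        sumOver (A ∪ B) v + x + f ((A ∩ B) ∷ʳ inside)
          ≤⟨ ℕ.+-monoˡ-≤ _ (in-bound p (A ∪ B)) ⟩
        f ((A ∪ B) ∷ʳ inside) + f ((A ∩ B) ∷ʳ inside)
          ≤⟨ submod A B inside inside ⟩
        f (A ∷ʳ inside) + f (B ∷ʳ inside)
          ≡⟨ cong₂ _+_ tA tB ⟨
        (sumOver A v + x) + (sumOver B v + x)
          ≡⟨ regroup (sumOver A v) (sumOver B v) x ⟩
        (sumOver A v + sumOver B v) + (x + x)
          ≡⟨ cong (_+ (x + x)) (sumOver-modular A B v) ⟨
        (sumOver (A ∪ B) v + sumOver (A ∩ B) v) + (x + x)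
          ≡⟨ regroup (sumOver (A ∪ B) v) (sumOver (A ∩ B) v) x ⟨
        sumOver (A ∪ B) v + x + (sumOver (A ∩ B) v + x) ∎))
      where
      open ℕ.≤-Reasoning
      open ℕSolver.+-*-Solver
      regroup : ∀ a b x → (a + x) + (b + x) ≡ (a + b) + (x + x)
      regroup = solve 3 (λ a b x → (a :+ x) :+ (b :+ x) := (a :+ b) :+ (x :+ x)) refl

    tight-⊤ : Tight ⊤
    tight-⊤ = trans (total-eq p) (sym ⊤-in)

    -- Indices are treated one at a time along `g`, starting from the tight set `⊤`. An index with
    -- positive entry is removed by intersecting with its blocking set; one with entry 0 may stay.
    tight-avoiding : (∀ j {w} → lookup v j ≡ suc w → ∃ λ A → lookup A j ≡ false × Tight A) →
      ∀ m (g : Fin m → Fin n) → ∃ λ A → Tight A × (∀ i → lookup A (g i) ≡ true → lookup v (g i) ≡ 0)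
    tight-avoiding block zero g = ⊤ , tight-⊤ , λ ()
    tight-avoiding block (suc m) g with tight-avoiding block m (g ∘ suc)
    ... | A , tA , null with lookup v (g zero) in eq
    ...   | zero = A , tA , λ { zero _ → eq ; (suc i) → null i }
    ...   | suc w with block (g zero) eq
    ...     | B , gz∉B , tB = A ∩ B , tight-∩ tA tB , null′
      where
      ∈∩ : ∀ i → lookup (A ∩ B) i ≡ true → lookup A i ≡ true × lookup B i ≡ true
      ∈∩ i e = ∧-true (trans (sym (lookup-zipWith _∧_ i A B)) e)
      null′ : ∀ i → lookup (A ∩ B) (g i) ≡ true → lookup v (g i) ≡ 0
      null′ zero e with () ← trans (sym gz∉B) (proj₂ (∈∩ (g zero) e))
      null′ (suc i) e = null i (proj₁ (∈∩ (g (suc i)) e))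

    blocked⇒max : (∀ j {w} → lookup v j ≡ suc w → ∃ λ A → lookup A j ≡ false × Tight A) → lastMax f ≤ x
    blocked⇒max block with tight-avoiding block n id
    ... | A , tA , null = subst (lastMax f ≤_)
      (trans (sym tA) (cong (_+ x) (sumOver-null A v null))) (lastMax≤ A)

    -- Moving a unit from `j` to the last coordinate raises the sum only over sets that contain the
    -- last index and omit `j`, and only by 1. A tight set of this kind is thus the sole
    -- obstruction.
    exchange : ∀ j {w} → lookup v j ≡ suc w → ¬ (∃ λ A → lookup A j ≡ false × Tight A) →
      (updateAt v j (_∸ 1) ∷ʳ suc x) ∈P f
    exchange j {w} vj free = bound , (begin-equality
      sumOver ⊤ (v′ ∷ʳ suc x)             ≡⟨ cong (λ A → sumOver A (v′ ∷ʳ suc x)) (replicate-∷ʳ n inside) ⟨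
      sumOver (⊤ ∷ʳ inside) (v′ ∷ʳ suc x) ≡⟨ sumOver-in ⊤ v′ (suc x) ⟩
      total v′ + suc x                    ≡⟨ moved ⊤ (lookup-replicate j true) ⟩
      total v + x                         ≡⟨ total-eq p ⟩
      f ⊤                                 ∎)
      where
      open ℕ.≤-Reasoning
      v′ = updateAt v j (_∸ 1)
      moved : ∀ A → lookup A j ≡ true → sumOver A v′ + suc x ≡ sumOver A v + x
      moved A e = trans (trans (ℕ.+-suc _ x) (cong (_+ x) (ℕ.+-comm 1 (sumOver A v′))))
        (cong (_+ x) (subst (λ b → sumOver A v′ + (if b then 1 else 0) ≡ sumOver A v) e (sumOver-decrement A v j vj)))
      decreased : ∀ A → sumOver A v′ ≤ sumOver A v
      decreased A = ℕ.≤-trans (ℕ.m≤m+n _ _) (ℕ.≤-reflexive (sumOver-decrement A v j vj))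
      bound-in : ∀ A → sumOver A v′ + suc x ≤ f (A ∷ʳ inside)
      bound-in A with lookup A j in e
      ... | true = ℕ.≤-trans (ℕ.≤-reflexive (moved A e)) (in-bound p A)
      ... | false = ℕ.≤-trans (ℕ.≤-reflexive (ℕ.+-suc _ x)) (ℕ.≤-<-trans (ℕ.+-monoˡ-≤ x (decreased A))
        (ℕ.≤∧≢⇒< (in-bound p A) (λ tight → free (A , e , tight))))
      bound : ∀ A → sumOver A (v′ ∷ʳ suc x) ≤ f A
      bound A with initLast A
      ... | A′ , outside , refl = subst (_≤ f (A′ ∷ʳ outside)) (sym (sumOver-out A′ v′ (suc x)))
        (ℕ.≤-trans (decreased A′) (out-bound p A′))
      ... | A′ , inside , refl = subst (_≤ f (A′ ∷ʳ inside)) (sym (sumOver-in A′ v′ (suc x))) (bound-in A′)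

    into-last : ∀ j {w} → lookup v j ≡ suc w →
      minusPlus (v ∷ʳ x) (inject₁ j) (fromℕ n) ≡ just (updateAt v j (_∸ 1) ∷ʳ suc x)
    into-last j vj = trans (minusPlus-suc (v ∷ʳ x) (inject₁ j) (fromℕ n) (trans (lookup-inject₁ v x j) vj))
      (cong just (trans (cong (λ a → updateAt a (fromℕ n) suc) (updateAt-inject₁ v x j (_∸ 1)))
        (updateAt-fromℕ (updateAt v j (_∸ 1)) x suc)))

    active⇒max : extActive f (v ∷ʳ x) (fromℕ n) ≡ true → lastMax f ≤ x
    active⇒max e = blocked⇒max block
      where
      block : ∀ j {w} → lookup v j ≡ suc w → ∃ λ A → lookup A j ≡ false × Tight A
      -- Exhaustive search either yields the blocking set or makes the exchange possible, against
      -- activity.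
      block j vj with anySubset? (λ A → (lookup A j Bool.≟ false) ×-dec (sumOver A v + x ℕ.≟ f (A ∷ʳ inside)))
      ... | yes found = found
      ... | no none-tight with () ← trans
        (sym (none⁻ _ _ e (inject₁ j) (subst₂ _<_ (sym (Fin.toℕ-inject₁ j)) (sym (Fin.toℕ-fromℕ n)) (Fin.toℕ<n j))))
        (trans (cong (inP? f) (into-last j vj)) (∈P⇒inP f _ (exchange j vj none-tight)))

    max⇒active : lastMax f ≤ x → extActive f (v ∷ʳ x) (fromℕ n) ≡ true
    max⇒active max = none⁺ (fromℕ n) _ stuck
      where
      stuck : ∀ j → toℕ j < toℕ (fromℕ n) → inP? f (minusPlus (v ∷ʳ x) j (fromℕ n)) ≡ false
      stuck j lt with view j
      ... | ‵fromℕ = ⊥-elim (ℕ.<-irrefl refl lt)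
      ... | ‵inject₁ j′ with lookup v j′ in vj
      ...   | zero = cong (inP? f) (minusPlus-zero (v ∷ʳ x) (inject₁ j′) (fromℕ n) (trans (lookup-inject₁ v x j′) vj))
      ...   | suc w = trans (cong (inP? f) (into-last j′ vj)) (Bool.¬-not (λ e →
        ℕ.<⇒≱ (s≤s max) (x≤lastMax (inP⇒∈P f _ e))))

-- Sums over boxes

rangeSum : ℕ → (ℕ → ℕ) → ℕ
rangeSum zero g = 0
rangeSum (suc b) g = g 0 + rangeSum b (g ∘ suc)

boxSum : ∀ n → ℕ → (Vec ℕ n → ℕ) → ℕ
boxSum zero N φ = φ []
boxSum (suc n) N φ = boxSum n N (λ v → rangeSum (suc N) (λ x → φ (x ∷ v)))

rangeSum-cong : ∀ b {g h} → (∀ x → x < b → g x ≡ h x) → rangeSum b g ≡ rangeSum b h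
rangeSum-cong zero eq = refl
rangeSum-cong (suc b) eq = cong₂ _+_ (eq 0 (s≤s z≤n)) (rangeSum-cong b (λ x x<b → eq (suc x) (s≤s x<b)))

rangeSum-zero : ∀ b → rangeSum b (λ _ → 0) ≡ 0
rangeSum-zero zero = refl
rangeSum-zero (suc b) = rangeSum-zero b

rangeSum-+ : ∀ b g h → rangeSum b (λ x → g x + h x) ≡ rangeSum b g + rangeSum b h
rangeSum-+ zero g h = refl
rangeSum-+ (suc b) g h = trans (cong (_+_ (g 0 + h 0)) (rangeSum-+ b (g ∘ suc) (h ∘ suc)))
  (solve 4 (λ p q r s → (p :+ q) :+ (r :+ s) := (p :+ r) :+ (q :+ s)) refl (g 0) (h 0) _ _)
  where open ℕSolver.+-*-Solver

rangeSum-swap : ∀ a b (g : ℕ → ℕ → ℕ) →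
  rangeSum a (λ x → rangeSum b (g x)) ≡ rangeSum b (λ y → rangeSum a (λ x → g x y))
rangeSum-swap zero b g = sym (rangeSum-zero b)
rangeSum-swap (suc a) b g = trans (cong (_+_ (rangeSum b (g 0))) (rangeSum-swap a b (g ∘ suc)))
  (sym (rangeSum-+ b (g 0) (λ y → rangeSum a (λ x → g (suc x) y))))

rangeSum-truncate : ∀ {b N} g → b ≤ N → (∀ x → b ≤ x → x < N → g x ≡ 0) → rangeSum N g ≡ rangeSum b g
rangeSum-truncate {N = N} g z≤n vanish =
  trans (rangeSum-cong N (λ x → vanish x z≤n)) (rangeSum-zero N)
rangeSum-truncate g (s≤s b≤N) vanish = cong (_+_ (g 0))
  (rangeSum-truncate (g ∘ suc) b≤N (λ x b≤x x<N → vanish (suc x) (s≤s b≤x) (s≤s x<N)))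

rangeSum-last : ∀ b g → rangeSum (suc b) g ≡ g b + rangeSum b g
rangeSum-last zero g = refl
rangeSum-last (suc b) g = trans (cong (_+_ (g 0)) (rangeSum-last b (g ∘ suc)))
  (solve 3 (λ p q r → p :+ (q :+ r) := q :+ (p :+ r)) refl (g 0) (g (suc b)) _)
  where open ℕSolver.+-*-Solver

+rangeSum : ∀ b g → + rangeSum b g ≡ sumBelow b (λ x → + g x)
+rangeSum zero g = refl
+rangeSum (suc b) g = trans (ℤ.pos-+ (g 0) _) (cong (+ g 0 +ᶻ_) (+rangeSum b (g ∘ suc)))

boxSum-cong : ∀ n N {φ ψ : Vec ℕ n → ℕ} → (∀ v → φ v ≡ ψ v) → boxSum n N φ ≡ boxSum n N ψ
boxSum-cong zero N eq = eq []
boxSum-cong (suc n) N eq = boxSum-cong n N (λ v → rangeSum-cong (suc N) (λ x _ → eq (x ∷ v)))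

boxSum-zero : ∀ n N → boxSum n N (λ _ → 0) ≡ 0
boxSum-zero zero N = refl
boxSum-zero (suc n) N = trans (boxSum-cong n N (λ _ → rangeSum-zero N)) (boxSum-zero n N)

boxSum-rangeSum : ∀ n N b (φ : ℕ → Vec ℕ n → ℕ) →
  boxSum n N (λ v → rangeSum b (λ x → φ x v)) ≡ rangeSum b (λ x → boxSum n N (φ x))
boxSum-rangeSum zero N b φ = refl
boxSum-rangeSum (suc n) N b φ = trans
  (boxSum-cong n N (λ v → rangeSum-swap (suc N) b (λ y x → φ x (y ∷ v))))
  (boxSum-rangeSum n N b (λ x v → rangeSum (suc N) (λ y → φ x (y ∷ v))))

-- The box is enumerated head first while slices fix the last coordinate, so the sum over the last
-- coordinate is exchanged with all the others.
boxSum-last : ∀ n N (φ : Vec ℕ (suc n) → ℕ) →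
  boxSum (suc n) N φ ≡ rangeSum (suc N) (λ x → boxSum n N (λ v → φ (v ∷ʳ x)))
boxSum-last n N φ = trans (inner n φ) (boxSum-rangeSum n N (suc N) (λ x v → φ (v ∷ʳ x)))
  where
  inner : ∀ n (φ : Vec ℕ (suc n) → ℕ) →
    boxSum (suc n) N φ ≡ boxSum n N (λ v → rangeSum (suc N) (λ x → φ (v ∷ʳ x)))
  inner zero φ = refl
  inner (suc n) φ = trans
    (inner n (λ w → rangeSum (suc N) (λ x → φ (x ∷ w))))
    (boxSum-cong n N (λ v → rangeSum-swap (suc N) (suc N) (λ y x → φ (x ∷ (v ∷ʳ y)))))

weight : ∀ {n} → (Vec ℕ n → Bool) → (Vec ℕ n → ℕ) → ℕ → Vec ℕ n → ℕ
weight P deg k a = if P a then (if deg a ≡ᵇ k then 1 else 0) else 0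

sum-map-box : ∀ n N (φ : Vec ℕ n → ℕ) → sum (map φ (box n N)) ≡ boxSum n N φ
sum-map-box zero N φ = ℕ.+-identityʳ _
sum-map-box (suc n) N φ = trans (fibres (box n N)) (sum-map-box n N _)
  where
  range : ∀ b (g : ℕ → ℕ) → sum (applyUpTo g b) ≡ rangeSum b g
  range zero g = refl
  range (suc b) g = cong (_+_ (g 0)) (range b (g ∘ suc))
  fibres : ∀ vs → sum (map φ (concatMap (λ v → map (λ x → x ∷ v) (upTo (suc N))) vs))
                ≡ sum (map (λ v → rangeSum (suc N) (λ x → φ (x ∷ v))) vs)
  fibres []ₗ = refl
  fibres (v ∷ₗ vs) = begin
    sum (map φ (fibre ++ rest))          ≡⟨ cong sum (map-++ φ fibre rest) ⟩
    sum (map φ fibre ++ map φ rest)      ≡⟨ sum-++ (map φ fibre) (map φ rest) ⟩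
    sum (map φ fibre) + sum (map φ rest)           ≡⟨ cong₂ _+_ fibre-sum (fibres vs) ⟩
    rangeSum (suc N) (λ x → φ (x ∷ v)) + _         ∎
    where
    open ≡-Reasoning
    fibre rest : List (Vec ℕ (suc n))
    fibre = map (λ x → x ∷ v) (upTo (suc N))
    rest = concatMap (λ v → map (λ x → x ∷ v) (upTo (suc N))) vs
    fibre-sum : sum (map φ fibre) ≡ rangeSum (suc N) (λ x → φ (x ∷ v))
    fibre-sum = trans
      (cong sum (trans (sym (map-∘ (upTo (suc N)))) (map-applyUpTo id (λ x → φ (x ∷ v)) (suc N))))
      (range (suc N) (λ x → φ (x ∷ v)))

length-filter : ∀ {n} (P : Vec ℕ n → Bool) deg k N →
  length (filter (λ a → deg a ℕ.≟ k) (filter (λ a → P a Bool.≟ true) (box n N)))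
  ≡ boxSum n N (weight P deg k)
length-filter {n} P deg k N = trans (go (box n N)) (sum-map-box n N _)
  where
  go : ∀ as → length (filter (λ a → deg a ℕ.≟ k) (filter (λ a → P a Bool.≟ true) as))
            ≡ sum (map (weight P deg k) as)
  go []ₗ = refl
  go (a ∷ₗ as) with P a
  ... | false = go as
  ... | true with deg a ≡ᵇ k
  ...   | false = go as
  ...   | true = cong suc (go as)

extDegree : ∀ {n} → (Subset n → ℕ) → Vec ℕ n → ℕ
extDegree f a = codim (Ext f a)

extWeight : ∀ {n} → (Subset n → ℕ) → ℕ → Vec ℕ n → ℕ
extWeight f = weight (inP f) (extDegree f)

-- The box bound N is independent of f, so that it can stay fixed when passing to slices.
extCount : ∀ {n} → ℕ → (Subset n → ℕ) → ℕ → ℕ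
extCount {n} N f k = boxSum n N (extWeight f k)

-- Recursion for the exterior polynomial over its slices

module Recursion {n} (f : Subset (suc n) → ℕ) (rank : IsRankFunction (suc n) f) (N : ℕ) (r≤N : f ⊤ ≤ N) where
  open IsRankFunction rank
  open Split f rank
  open Slice f rank

  layer : ℕ → ℕ → ℕ
  layer k x = boxSum n N (λ v → extWeight f k (v ∷ʳ x))

  weight-outside : ∀ k v x → ¬ (x ≤ lastMax f × f ⊤ ∸ x ≤ f (⊤ ∷ʳ outside)) → extWeight f k (v ∷ʳ x) ≡ 0
  weight-outside k v x ¬ok with inP f (v ∷ʳ x) in e
  ... | false = refl
  ... | true = ⊥-elim (¬ok (x≤lastMax (inP⇒∈P f _ e) , r-x≤⊤out (inP⇒∈P f _ e)))

  layer-outside : ∀ k x → ¬ (x ≤ lastMax f × f ⊤ ∸ x ≤ f (⊤ ∷ʳ outside)) → layer k x ≡ 0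
  layer-outside k x ¬ok = trans (boxSum-cong n N (λ v → weight-outside k v x ¬ok)) (boxSum-zero n N)

  module _ {x} (x≤ : x ≤ lastMax f) (r-x≤ : f ⊤ ∸ x ≤ f (⊤ ∷ʳ outside)) where

    extDegree-active : ∀ v → extActive f (v ∷ʳ x) (fromℕ n) ≡ true → extDegree f (v ∷ʳ x) ≡ extDegree (slice f x) v
    extDegree-active v e = trans (cong codim (trans (Ext-slice x≤ r-x≤ v) (cong (Ext (slice f x) v ∷ʳ_) e)))
      (codim-in (Ext (slice f x) v))

    extDegree-inactive : ∀ v → extActive f (v ∷ʳ x) (fromℕ n) ≡ false → extDegree f (v ∷ʳ x) ≡ suc (extDegree (slice f x) v)
    extDegree-inactive v e = trans (cong codim (trans (Ext-slice x≤ r-x≤ v) (cong (Ext (slice f x) v ∷ʳ_) e)))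
      (codim-out (Ext (slice f x) v))

  layer-below : ∀ k x → x < lastMax f → f ⊤ ∸ x ≤ f (⊤ ∷ʳ outside) →
    + layer k x ≡ shift (λ j → + extCount N (slice f x) j) k
  layer-below k x x< r-x≤ = go k
    where
    x≤ = ℕ.<⇒≤ x<
    inactive : ∀ v → inP (slice f x) v ≡ true → extDegree f (v ∷ʳ x) ≡ suc (extDegree (slice f x) v)
    inactive v e = extDegree-inactive x≤ r-x≤ v (Bool.¬-not (λ act →
      ℕ.<⇒≱ x< (active⇒max (inP⇒∈P f _ (trans (inP-slice x≤ r-x≤ v) e)) act)))
    at-zero : ∀ v → extWeight f 0 (v ∷ʳ x) ≡ 0
    at-zero v rewrite inP-slice x≤ r-x≤ v with inP (slice f x) v in e
    ... | false = refl
    ... | true rewrite inactive v e = refl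
    at-suc : ∀ j v → extWeight f (suc j) (v ∷ʳ x) ≡ extWeight (slice f x) j v
    at-suc j v rewrite inP-slice x≤ r-x≤ v with inP (slice f x) v in e
    ... | false = refl
    ... | true rewrite inactive v e = refl
    go : ∀ k → + layer k x ≡ shift (λ j → + extCount N (slice f x) j) k
    go zero = cong +_ (trans (boxSum-cong n N at-zero) (boxSum-zero n N))
    go (suc j) = cong +_ (boxSum-cong n N (at-suc j))

  r-lastMax≤ : f ⊤ ∸ lastMax f ≤ f (⊤ ∷ʳ outside)
  r-lastMax≤ = ℕ.m≤n+o⇒m∸n≤o (f ⊤) (lastMax f) (subst₂ _≤_ ⊤-in (ℕ.+-comm _ (lastMax f)) (in≤out+lastMax ⊤))

  layer-max : ∀ k → layer k (lastMax f) ≡ extCount N (slice f (lastMax f)) k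
  layer-max k = boxSum-cong n N eq
    where
    eq : ∀ v → extWeight f k (v ∷ʳ lastMax f) ≡ extWeight (slice f (lastMax f)) k v
    eq v rewrite inP-slice ℕ.≤-refl r-lastMax≤ v with inP (slice f (lastMax f)) v in e
    ... | false = refl
    ... | true rewrite extDegree-active ℕ.≤-refl r-lastMax≤ v
      (max⇒active (inP⇒∈P f _ (trans (inP-slice ℕ.≤-refl r-lastMax≤ v) e)) ℕ.≤-refl) = refl

  extCount-rec : ∀ k → + extCount N f k ≡
    + extCount N (slice f (lastMax f)) k +ᶻ sumBelow (lastMax f) (λ x → + layer k x)
  extCount-rec k = begin
    + extCount N f k                    ≡⟨ cong +_ (boxSum-last n N (extWeight f k)) ⟩
    + rangeSum (suc N) (layer k)        ≡⟨ cong +_ (rangeSum-truncate (layer k) (s≤s (ℕ.≤-trans lastMax≤⊤ r≤N))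
                                             (λ x β<x _ → layer-outside k x (λ ok → ℕ.<⇒≱ β<x (proj₁ ok)))) ⟩
    + rangeSum (suc β) (layer k)        ≡⟨ cong +_ (rangeSum-last β (layer k)) ⟩
    + (layer k β + rangeSum β (layer k)) ≡⟨ ℤ.pos-+ (layer k β) _ ⟩
    + layer k β +ᶻ + rangeSum β (layer k) ≡⟨ cong₂ _+ᶻ_ (cong +_ (layer-max k)) (+rangeSum β (layer k)) ⟩
    + extCount N (slice f β) k +ᶻ sumBelow β (λ x → + layer k x) ∎
    where
    open ≡-Reasoning
    β = lastMax f

-- The induction needs `m` free: slices below the maximum carry a factor y and are known to be
-- nearly spanning only in a smaller range. For n = 0 the rank is 0, no set is non-spanning, and
-- both sides are the series 1.
extCount-formula : ∀ n (f : Subset n → ℕ) → IsRankFunction n f → ∀ m N → f ⊤ ≤ N → NearlySpanning m f →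
  (λ k → + extCount N f k) ≗[ m ] psums (f ⊤) (series (nonspanning f))
extCount-formula zero f rank m N r≤N near k k<m = base (IsRankFunction.f-empty rank) k
  where
  base : f [] ≡ 0 → ∀ k → + extCount N f k ≡ psums (f ⊤) (series (nonspanning f)) k
  base e zero rewrite e = refl
  base e (suc k) rewrite e = refl
extCount-formula (suc n) f rank m N r≤N near = main
  where
  open IsRankFunction rank
  open Split f rank
  open Slices f rank m near renaming (N to F)
  open Recursion f rank N r≤N
  r β : ℕ
  r = f ⊤
  β = lastMax f
  e₁ e₀ : Seq
  e₁ = series (F ↾ inside)
  e₀ = series (F ↾ outside)

  codim-anti : ∀ {A B : Subset n} → A ⊆ B → codim B ≤ codim A
  codim-anti A⊆B = ℕ.∸-monoʳ-≤ n (p⊆q⇒∣p∣≤∣q∣ A⊆B)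

  slice-formula : ∀ {x} m′ → x ≤ β → r ∸ x ≤ f (⊤ ∷ʳ outside) → m′ ≤ m →
    (∀ A → codim A < m′ → r ∸ x ≤ suc (f (A ∷ʳ outside))) →
    (λ k → + extCount N (slice f x) k) ≗[ m′ ] psums (r ∸ x) (series (nonspanning (slice f x)))
  slice-formula {x} m′ x≤ r-x≤ m′≤m near-o = subst
    (λ s → (λ k → + extCount N (slice f x) k) ≗[ m′ ] psums s (series (nonspanning (slice f x))))
    (slice-⊤ x r-x≤)
    (extCount-formula n (slice f x) (slice-isRankFunction x≤) m′ N
      (ℕ.≤-trans (ℕ.≤-reflexive (slice-⊤ x r-x≤)) (ℕ.≤-trans (ℕ.m∸n≤m r x) r≤N))
      near′)
    where
    near′ : NearlySpanning m′ (slice f x)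
    near′ A c = subst (_≤ suc (slice f x A)) (sym (slice-⊤ x r-x≤)) (ℕ.⊓-glb (near-o A c)
      (subst (r ∸ x ≤_) (ℕ.+-∸-assoc 1 (ℕ.≤-trans x≤ (lastMax≤ A)))
        (ℕ.∸-monoˡ-≤ x (near-in A (ℕ.<-≤-trans c m′≤m)))))

  max-formula : (λ k → + extCount N (slice f β) k) ≗[ m ] psums (r ∸ β) e₁
  max-formula k k<m = trans
    (slice-formula m ℕ.≤-refl r-lastMax≤ ℕ.≤-refl near-o k k<m)
    (psums-local (r ∸ β) {m = m} (λ j _ → series-local _ _ j (λ A _ B _ →
      slice-nonspanning ℕ.≤-refl r-lastMax≤ B (in<r B))) k k<m)
    where
    -- `A ∷ʳ outside` may have codimension `m`, out of reach of `near`; the bound goes through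
    -- `A ∷ʳ inside`, whose rank exceeds the other by at most `β`.
    near-o : ∀ A → codim A < m → r ∸ β ≤ suc (f (A ∷ʳ outside))
    near-o A c = ℕ.m≤n+o⇒m∸n≤o r β (ℕ.≤-trans (near-in A c)
      (subst (suc (f (A ∷ʳ inside)) ≤_) (ℕ.+-comm (suc (f (A ∷ʳ outside))) β) (s≤s (in≤out+lastMax A))))
    in<r : ∀ A → f (A ∷ʳ outside) < r ∸ β → f (A ∷ʳ inside) < r
    in<r A lt = ℕ.≤-<-trans (in≤out+lastMax A) (ℕ.m≤o∸n⇒m+n≤o _ lastMax≤⊤ lt)

  ⊤out-near : ∀ {j} → suc j < m → r ≤ suc (f (⊤ ∷ʳ outside))
  ⊤out-near {j} sj<m = near-out ⊤ (subst (λ c → suc c < m) (sym (trans (cong (n ∸_) (∣⊤∣≡n n)) (ℕ.n∸n≡0 n)))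
    (ℕ.≤-<-trans (s≤s z≤n) sj<m))

  layer-at-0 : ∀ x → x < β → + layer 0 x ≡ 0ℤ
  layer-at-0 x x<β with f ⊤ ∸ x ℕ.≤? f (⊤ ∷ʳ outside)
  ... | yes ok = layer-below 0 x x<β ok
  ... | no ¬ok = cong +_ (layer-outside 0 x (¬ok ∘ proj₂))

  -- In range `A ∷ʳ outside` has rank at least r - 1, hence at least r - x for every x > 0. Only the
  -- inside branch of the slice can then fall short, so the family is `F ↾ inside` for each such x.
  layer-suc : ∀ k → k < m → ∀ t → suc t < β → + layer k (suc t) ≡ shift (psums (r ∸ suc t) e₁) k
  layer-suc zero _ t t<β = layer-at-0 (suc t) t<β
  layer-suc (suc j) k<m t t<β = trans (layer-below (suc j) (suc t) t<β ok) (trans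
    (slice-formula (suc j) (ℕ.<⇒≤ t<β) ok (ℕ.<⇒≤ k<m) near-o j (ℕ.n<1+n j))
    (psums-local (r ∸ suc t) {m = suc j} (λ i i≤j → series-local _ _ i (λ A c B A⊆B →
      slice-nonspanning (ℕ.<⇒≤ t<β) ok B (λ lt → ⊥-elim (ℕ.<⇒≱ lt
        (r-x≤ B (ℕ.≤-<-trans (codim-anti A⊆B) (subst (_< suc j) (sym c) i≤j))))))) j (ℕ.n<1+n j)))
    where
    r-x≤ : ∀ A → codim A < suc j → r ∸ suc t ≤ f (A ∷ʳ outside)
    r-x≤ A c = ℕ.≤-trans (ℕ.∸-monoˡ-≤ (suc t) (near-out A (ℕ.≤-<-trans c k<m))) (ℕ.m∸n≤m _ t)
    ok : r ∸ suc t ≤ f (⊤ ∷ʳ outside)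
    ok = ℕ.≤-trans (ℕ.∸-monoˡ-≤ (suc t) (⊤out-near k<m)) (ℕ.m∸n≤m _ t)
    near-o : ∀ A → codim A < suc j → r ∸ suc t ≤ suc (f (A ∷ʳ outside))
    near-o A c = ℕ.m≤n⇒m≤1+n (r-x≤ A c)

  -- If f (⊤ ∷ʳ outside) < r, the slice at 0 is empty and F ↾ outside contains all sets.
  layer-0 : ∀ k → k < m → 0 < β → + layer k 0 ≡ shift (psums r e₀) k
  layer-0 zero _ 0<β = layer-at-0 0 0<β
  layer-0 (suc j) k<m 0<β with r ℕ.≤? f (⊤ ∷ʳ outside)
  ... | no ¬ok = trans (cong +_ (layer-outside (suc j) 0 (¬ok ∘ proj₂))) (sym (trans
    (psums-local r {m = suc j} (λ i _ → series-of-top (F ↾ outside) top i) j (ℕ.n<1+n j)) (psums-zero r j)))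
    where
    top : ∀ A → F (A ∷ʳ outside) ≡ true
    top A = <⇒<ᵇ _ (f ⊤) (ℕ.≤-<-trans (mono outside (⊆-max A)) (ℕ.≰⇒> ¬ok))
  -- At x = 0 the minimum defining the slice is always its outside branch, which produces
  -- `F ↾ outside`.
  ... | yes ok = trans (layer-below (suc j) 0 0<β ok) (trans
    (slice-formula (suc j) z≤n ok (ℕ.<⇒≤ k<m) (λ A c → near-out A (ℕ.≤-<-trans c k<m)) j (ℕ.n<1+n j))
    (psums-local r {m = suc j} (λ i _ → series-local _ _ i (λ A _ B _ →
      cong₂ _<ᵇ_ (ℕ.m≤n⇒m⊓n≡m (out≤in B)) (slice-⊤ 0 ok))) j (ℕ.n<1+n j)))

  recombined : Seq
  recombined k = e₁ k +ᶻ (shift e₀ k -ᶻ shift e₁ k)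

  target : ∀ k → k < m →
    psums r (series F) k ≡ psums r e₁ k +ᶻ (shift (psums r e₀) k -ᶻ shift (psums r e₁) k)
  target k k<m = trans (psums-local r {v = recombined} (series-rec m F agree) k k<m)
    (psums-affine r {u = recombined} {v = e₁} (λ _ → refl) k)

  assemble : ∀ b → b ≡ β → ∀ k → k < m →
    psums (r ∸ b) e₁ k +ᶻ sumBelow b (λ x → + layer k x)
    ≡ psums r e₁ k +ᶻ (shift (psums r e₀) k -ᶻ shift (psums r e₁) k)
  -- If β = 0 the slice at 0 is the maximal one. Adding the last element never changes the rank, so
  -- e₀ and e₁ coincide and the correction vanishes.
  assemble zero β≡0 k k<m = cong (psums r e₁ k +ᶻ_) (sym (trans
    (cong (_-ᶻ shift (psums r e₁) k) (shift-local {m = m} (λ j j<m →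
      psums-local r {m = m} (λ i _ → series-local _ _ i (λ A _ B _ → cong (_<ᵇ f ⊤) (ℕ.≤-antisym (out≤in B)
        (ℕ.≤-trans (in≤out+lastMax B) (ℕ.≤-reflexive
          (trans (cong (_+_ (f (B ∷ʳ outside))) (sym β≡0)) (ℕ.+-identityʳ _))))))) j (ℕ.<-trans (ℕ.n<1+n j) j<m)) k k<m))
    (ℤ.+-inverseʳ (shift (psums r e₁) k))))
  assemble (suc b) β≡ k k<m = trans
    (psums-telescope r b e₁ k (λ x → + layer k x) (subst (_≤ r) (sym β≡) lastMax≤⊤)
      (λ t t<b → layer-suc k k<m t (subst (suc t <_) β≡ (s≤s t<b))))
    (cong (λ z → psums r e₁ k +ᶻ (z -ᶻ shift (psums r e₁) k)) (layer-0 k k<m (subst (0 <_) β≡ (s≤s z≤n))))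

  main : (λ k → + extCount N f k) ≗[ m ] psums r (series F)
  main k k<m = trans (extCount-rec k) (trans
    (cong (_+ᶻ sumBelow β (λ x → + layer k x)) (max-formula k k<m))
    (trans (assemble β refl k k<m) (sym (target k k<m))))

-- Unimodality from the formula

count-at-0 : ∀ {n} (N : Family n) → count N 0 ≤ 1
count-at-0 {zero} N with N []
... | false = z≤n
... | true = ℕ.≤-refl
count-at-0 {suc n} N = count-at-0 (N ↾ inside)

extCount-unimodal : ∀ {n} (f : Subset n → ℕ) → IsRankFunction n f → ∀ m N → f ⊤ ≤ N → NearlySpanning m f →
  Unimodal m (extCount N f)
extCount-unimodal f rank m N r≤N near = psums-unimodal m (f ⊤) (series (nonspanning f)) (extCount N f)
  -- Only the full set has codimension 0, so the constant term is 1 minus at most 1; all later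
  -- coefficients are negated counts.
  (ℤ.i≤j⇒0≤j-i (ℤ.+≤+ (count-at-0 (maximal (nonspanning f)))))
  (λ k → ℤ.i≤j⇒i-j≤0 {0ℤ} (ℤ.+≤+ (z≤n {count (maximal (nonspanning f)) (suc k)})))
  (extCount-formula _ f rank m N r≤N near)

Unimodal-cong : ∀ {m s t} → (∀ k → s k ≡ t k) → Unimodal m s → Unimodal m t
Unimodal-cong eq (p , up , down) =
  p , (λ i a b → subst₂ _≤_ (eq i) (eq (suc i)) (up i a b)) , (λ i a b → subst₂ _≤_ (eq (suc i)) (eq i) (down i a b))

minOr-≤ : ∀ d {x} xs → x ∈ₗ xs → minOr d xs ≤ x
minOr-≤ d (x ∷ₗ xs) (Any.here refl) = ℕ.m⊓n≤m x _
minOr-≤ d (x ∷ₗ xs) (Any.there x∈) = ℕ.≤-trans (ℕ.m⊓n≤n x _) (minOr-≤ d xs x∈)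

∈-allSubsets : ∀ {n} (A : Subset n) → A ∈ₗ allSubsets n
∈-allSubsets [] = Any.here refl
∈-allSubsets (b ∷ A) = ∈-concatMap⁺ _ (Any.map (λ { refl → pick b }) (∈-allSubsets A))
  where
  pick : ∀ b → (b ∷ A) ∈ₗ ((inside ∷ A) ∷ₗ ((outside ∷ A) ∷ₗ []ₗ))
  pick inside = Any.here refl
  pick outside = Any.there (Any.here refl)

r₂-near : ∀ {n} (f : Subset n → ℕ) → NearlySpanning (r₂ f) f
r₂-near {n} f A c = ℕ.≮⇒≥ λ lt → ℕ.<⇒≱ c (minOr-≤ (suc n) _ (∈-map⁺ (λ F → n ∸ ∣ F ∣)
  (∈-filter⁺ (λ F → f F + 2 ℕ.≤? f ⊤) (∈-allSubsets A) (subst (_≤ f ⊤) (ℕ.+-comm 2 (f A)) lt))))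

-- The dual polymatroid { m - a : a ∈ P }, where m i = f ⁅ i ⁆

sumOver-split : ∀ {n} (A B : Subset n) v → sumOver (A ∩ B) v + sumOver (∁ A ∩ B) v ≡ sumOver B v
sumOver-split [] [] [] = refl
sumOver-split (false ∷ A) (b ∷ B) (x ∷ v) = trans
  (solve 3 (λ p q r → p :+ (q :+ r) := q :+ (p :+ r)) refl (sumOver (A ∩ B) v) (if b then x else 0) _)
  (cong (_+_ (if b then x else 0)) (sumOver-split A B v))
  where open ℕSolver.+-*-Solver
sumOver-split (true ∷ A) (b ∷ B) (x ∷ v) = trans (ℕ.+-assoc (if b then x else 0) _ _)
  (cong (_+_ (if b then x else 0)) (sumOver-split A B v))

∩-⊆ : ∀ {n} {A B : Subset n} → A ⊆ B → A ∩ B ≡ A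
∩-⊆ {A = A} {B} A⊆B = ⊆-antisym (p∩q⊆p A B) (λ x∈A → x∈p∩q⁺ (x∈A , A⊆B x∈A))

sumOver-∁ : ∀ {n} (A : Subset n) v → sumOver A v + sumOver (∁ A) v ≡ total v
sumOver-∁ A v = trans (sym (cong₂ (λ B C → sumOver B v + sumOver C v) (∩-⊆ (⊆-max A)) (∩-⊆ (⊆-max (∁ A)))))
  (sumOver-split A ⊤ v)

sumOver-singleton : ∀ {n} (i : Fin n) v → sumOver ⁅ i ⁆ v ≡ lookup v i
sumOver-singleton zero (x ∷ v) = trans (cong (_+_ x) (sumOver-⊥ v)) (ℕ.+-identityʳ x)
sumOver-singleton (suc i) (x ∷ v) = sumOver-singleton i v

_≤ᵛ_ : ∀ {n} → Vec ℕ n → Vec ℕ n → Set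
a ≤ᵛ m = ∀ i → lookup a i ≤ lookup m i

_∸ᵛ_ : ∀ {n} → Vec ℕ n → Vec ℕ n → Vec ℕ n
m ∸ᵛ a = zipWith _∸_ m a

sumOver-∸ᵛ : ∀ {n} (A : Subset n) m a → a ≤ᵛ m → sumOver A (m ∸ᵛ a) + sumOver A a ≡ sumOver A m
sumOver-∸ᵛ [] [] [] le = refl
sumOver-∸ᵛ (false ∷ A) (x ∷ m) (y ∷ a) le = sumOver-∸ᵛ A m a (le ∘ suc)
sumOver-∸ᵛ (true ∷ A) (x ∷ m) (y ∷ a) le = trans
  (solve 4 (λ p q r s → (p :+ q) :+ (r :+ s) := (p :+ r) :+ (q :+ s)) refl (x ∸ y) (sumOver A (m ∸ᵛ a)) y _)
  (cong₂ _+_ (ℕ.m∸n+n≡m (le zero)) (sumOver-∸ᵛ A m a (le ∘ suc)))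
  where open ℕSolver.+-*-Solver

∸ᵛ-suc : ∀ {n} (m a : Vec ℕ n) j → m ∸ᵛ updateAt a j suc ≡ updateAt (m ∸ᵛ a) j (_∸ 1)
∸ᵛ-suc (x ∷ m) (y ∷ a) zero = cong (_∷ (m ∸ᵛ a)) (sym (ℕ.pred[m∸n]≡m∸[1+n] x y))
∸ᵛ-suc (x ∷ m) (y ∷ a) (suc j) = cong ((x ∸ y) ∷_) (∸ᵛ-suc m a j)

∸ᵛ-pred : ∀ {n} (m a : Vec ℕ n) i {w} → lookup a i ≡ suc w → a ≤ᵛ m →
  m ∸ᵛ updateAt a i (_∸ 1) ≡ updateAt (m ∸ᵛ a) i suc
∸ᵛ-pred (x ∷ m) (suc w ∷ a) zero refl le = cong (_∷ (m ∸ᵛ a)) (ℕ.+-∸-assoc 1 (le zero))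
∸ᵛ-pred (x ∷ m) (y ∷ a) (suc i) eq le = cong ((x ∸ y) ∷_) (∸ᵛ-pred m a i eq (le ∘ suc))

-- The map sending a to m - a reflects the box of vectors below `m`, but not the uniform box of
-- `boxSum`; sums are cut down to the former before reflecting.
capSum : ∀ {n} → Vec ℕ n → (Vec ℕ n → ℕ) → ℕ
capSum [] φ = φ []
capSum (x ∷ m) φ = capSum m (λ v → rangeSum (suc x) (λ y → φ (y ∷ v)))

capSum-cong : ∀ {n} (m : Vec ℕ n) {φ ψ} → (∀ v → v ≤ᵛ m → φ v ≡ ψ v) → capSum m φ ≡ capSum m ψ
capSum-cong [] eq = eq [] (λ ())
capSum-cong (x ∷ m) eq = capSum-cong m (λ v v≤m → rangeSum-cong (suc x)
  (λ y y≤x → eq (y ∷ v) λ { zero → ℕ.≤-pred y≤x ; (suc i) → v≤m i }))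

rangeSum-reverse : ∀ b g → rangeSum (suc b) g ≡ rangeSum (suc b) (λ y → g (b ∸ y))
rangeSum-reverse zero g = refl
rangeSum-reverse (suc b) g = trans (rangeSum-last (suc b) g) (cong (_+_ (g (suc b))) (rangeSum-reverse b g))

capSum-reverse : ∀ {n} (m : Vec ℕ n) φ → capSum m φ ≡ capSum m (λ a → φ (m ∸ᵛ a))
capSum-reverse [] φ = refl
capSum-reverse (x ∷ m) φ = trans
  (capSum-cong m (λ v _ → rangeSum-reverse x (λ y → φ (y ∷ v))))
  (capSum-reverse m (λ v → rangeSum (suc x) (λ y → φ ((x ∸ y) ∷ v))))

boxSum-capSum : ∀ {n} N (m : Vec ℕ n) φ → (∀ i → lookup m i ≤ N) →
  (∀ v i → lookup m i < lookup v i → φ v ≡ 0) → boxSum n N φ ≡ capSum m φ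
boxSum-capSum N [] φ m≤N vanish = refl
boxSum-capSum {suc n} N (x ∷ m) φ m≤N vanish = trans
  (boxSum-cong n N (λ v → rangeSum-truncate (λ y → φ (y ∷ v)) (s≤s (m≤N zero)) (λ y x<y _ → vanish (y ∷ v) zero x<y)))
  (boxSum-capSum N m (λ v → rangeSum (suc x) (λ y → φ (y ∷ v))) (m≤N ∘ suc)
    (λ v i lt → trans (rangeSum-cong (suc x) (λ y _ → vanish (y ∷ v) (suc i) lt)) (rangeSum-zero (suc x))))

singletons : ∀ {n} → (Subset n → ℕ) → Vec ℕ n
singletons f = tabulate (λ i → f ⁅ i ⁆)

-- The dual rank of a matroid, |A| + r(E - A) - r(E), with the cardinality replaced by the sum of
-- singleton ranks. For a rank function the truncated subtraction is exact, by `f⊤≤`.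
dual : ∀ {n} → (Subset n → ℕ) → Subset n → ℕ
dual f A = sumOver A (singletons f) + f (∁ A) ∸ f ⊤

rank≤singletons : ∀ {n} (f : Subset n → ℕ) → IsRankFunction n f → ∀ A → f A ≤ sumOver A (singletons f)
rank≤singletons f rank [] = ℕ.≤-reflexive (IsRankFunction.f-empty rank)
rank≤singletons {suc n} f rank (b ∷ A) = go b
  where
  open IsRankFunction rank
  rest : f (outside ∷ A) ≤ sumOver A (singletons (λ B → f (outside ∷ B)))
  rest = rank≤singletons (λ B → f (outside ∷ B)) (record
    { f-empty = f-empty
    ; monotone = λ B C B⊆C → monotone _ _ (s⊆s B⊆C)
    ; submodular = λ B C → submodular (outside ∷ B) (outside ∷ C)
    }) A
  go : ∀ b → f (b ∷ A) ≤ sumOver (b ∷ A) (singletons f)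
  go outside = rest
  go inside = ℕ.≤-trans (ℕ.≤-trans (ℕ.m≤m+n _ _)
    (subst (λ B → f (inside ∷ B) + f (outside ∷ (⊥ ∩ A)) ≤ f (inside ∷ ⊥) + f (outside ∷ A))
      (∪-identityˡ A) (submodular (inside ∷ ⊥) (outside ∷ A))))
    (ℕ.+-monoʳ-≤ (f (inside ∷ ⊥)) rest)

module Dual {n} (f : Subset n → ℕ) (rank : IsRankFunction n f) where
  open IsRankFunction rank
  open import Algebra.Lattice.Properties.BooleanAlgebra (∪-∩-booleanAlgebra n)
    using (deMorgan₁; deMorgan₂; ¬-involutive)

  m : Vec ℕ n
  m = singletons f

  g : Subset n → ℕ
  g = dual f

  f-subadditive : ∀ A B → f (A ∪ B) ≤ f A + f B
  f-subadditive A B = ℕ.≤-trans (ℕ.m≤m+n _ _) (submodular A B)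

  f⊤≤ : ∀ A → f ⊤ ≤ sumOver A m + f (∁ A)
  f⊤≤ A = ℕ.≤-trans (subst (λ B → f B ≤ f A + f (∁ A)) (p∪∁p≡⊤ A) (f-subadditive A (∁ A)))
    (ℕ.+-monoˡ-≤ _ (rank≤singletons f rank A))

  f∁⊤ : f (∁ ⊤) ≡ 0
  f∁⊤ = trans (cong f (map-replicate not true n)) f-empty

  g⊤ : g ⊤ ≡ total m ∸ f ⊤
  g⊤ = cong (_∸ f ⊤) (trans (cong (_+_ (total m)) f∁⊤) (ℕ.+-identityʳ (total m)))

  f⊤≤total : f ⊤ ≤ total m
  f⊤≤total = rank≤singletons f rank ⊤

  g+f⊤ : ∀ A → g A + f ⊤ ≡ sumOver A m + f (∁ A)
  g+f⊤ A = ℕ.m∸n+n≡m (f⊤≤ A)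

  dual-isRankFunction : IsRankFunction n g
  dual-isRankFunction = record
    { f-empty = trans (cong₂ (λ p q → p + q ∸ f ⊤) (sumOver-⊥ m) (cong f (map-replicate not false n))) (ℕ.n∸n≡0 (f ⊤))
    ; monotone = λ A B A⊆B → ℕ.∸-monoˡ-≤ (f ⊤) (mono A B A⊆B)
    ; submodular = λ A B → ℕ.+-cancelʳ-≤ (f ⊤ + f ⊤) _ _ (subst₂ _≤_ (expand (A ∪ B) (A ∩ B)) (expand A B) (sub A B))
    }
    where
    open ℕSolver.+-*-Solver
    -- Passing from `A` to `B` gains the singleton ranks over `∁ A ∩ B`, which pay for removing that
    -- part from `∁ A`.
    mono : ∀ A B → A ⊆ B → sumOver A m + f (∁ A) ≤ sumOver B m + f (∁ B)
    mono A B A⊆B = begin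
      sumOver A m + f (∁ A)
        ≤⟨ ℕ.+-monoʳ-≤ (sumOver A m) (ℕ.≤-trans (monotone _ _ cover) (f-subadditive (∁ A ∩ B) (∁ B))) ⟩
      sumOver A m + (f (∁ A ∩ B) + f (∁ B))
        ≤⟨ ℕ.+-monoʳ-≤ (sumOver A m) (ℕ.+-monoˡ-≤ (f (∁ B)) (rank≤singletons f rank (∁ A ∩ B))) ⟩
      sumOver A m + (sumOver (∁ A ∩ B) m + f (∁ B))
        ≡⟨ ℕ.+-assoc (sumOver A m) _ _ ⟨
      sumOver A m + sumOver (∁ A ∩ B) m + f (∁ B)
        ≡⟨ cong (_+ f (∁ B)) (trans (cong (λ C → sumOver C m + sumOver (∁ A ∩ B) m) (sym (∩-⊆ A⊆B))) (sumOver-split A B m)) ⟩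
      sumOver B m + f (∁ B) ∎
      where
      open ℕ.≤-Reasoning
      cover : ∁ A ⊆ (∁ A ∩ B) ∪ ∁ B
      cover {x} x∈∁A with x ∈? B
      ... | yes x∈B = x∈p∪q⁺ (inj₁ (x∈p∩q⁺ (x∈∁A , x∈B)))
      ... | no x∉B = x∈p∪q⁺ (inj₂ (x∉p⇒x∈∁p x∉B))
    swap : ∀ p q r s → (p + q) + (r + s) ≡ (p + r) + (q + s)
    swap = solve 4 (λ p q r s → (p :+ q) :+ (r :+ s) := (p :+ r) :+ (q :+ s)) refl
    expand : ∀ A B → (sumOver A m + f (∁ A)) + (sumOver B m + f (∁ B)) ≡ g A + g B + (f ⊤ + f ⊤)
    expand A B = trans (cong₂ _+_ (sym (g+f⊤ A)) (sym (g+f⊤ B))) (swap (g A) (f ⊤) (g B) (f ⊤))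
    sub : ∀ A B → (sumOver (A ∪ B) m + f (∁ (A ∪ B))) + (sumOver (A ∩ B) m + f (∁ (A ∩ B)))
                ≤ (sumOver A m + f (∁ A)) + (sumOver B m + f (∁ B))
    sub A B = subst₂ _≤_ (swap (sumOver (A ∪ B) m) _ _ _) (swap (sumOver A m) _ _ _)
      (ℕ.+-mono-≤ (ℕ.≤-reflexive (sumOver-modular A B m))
        (subst (_≤ f (∁ A) + f (∁ B))
          (trans (ℕ.+-comm _ (f (∁ A ∩ ∁ B))) (sym (cong₂ (λ C D → f C + f D) (deMorgan₂ A B) (deMorgan₁ A B))))
          (submodular (∁ A) (∁ B))))

  ∈P-bound : ∀ {a} → a ∈P f → a ≤ᵛ m
  ∈P-bound {a} (le , _) i = subst₂ _≤_ (sumOver-singleton i a) (sym (lookup∘tabulate _ i)) (le ⁅ i ⁆)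

  ∈P-dual-bound : ∀ {b} → b ∈P g → b ≤ᵛ m
  ∈P-dual-bound {b} (le , _) i = begin
    lookup b i             ≡⟨ sumOver-singleton i b ⟨
    sumOver ⁅ i ⁆ b        ≤⟨ le ⁅ i ⁆ ⟩
    g ⁅ i ⁆                ≤⟨ ℕ.m≤n+o⇒m∸n≤o _ (f ⊤) (subst (sumOver ⁅ i ⁆ m + f (∁ ⁅ i ⁆) ≤_) (ℕ.+-comm _ (f ⊤))
                                (ℕ.+-monoʳ-≤ (sumOver ⁅ i ⁆ m) (monotone _ _ (⊆-max (∁ ⁅ i ⁆))))) ⟩
    sumOver ⁅ i ⁆ m        ≡⟨ sumOver-singleton i m ⟩
    lookup m i             ∎
    where open ℕ.≤-Reasoning

  inP-dual : ∀ a → a ≤ᵛ m → inP f a ≡ inP g (m ∸ᵛ a)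
  inP-dual a a≤m = inP-cong f a g b to from
    where
    b : Vec ℕ n
    b = m ∸ᵛ a
    b+a : ∀ A → sumOver A b + sumOver A a ≡ sumOver A m
    b+a A = sumOver-∸ᵛ A m a a≤m
    to : a ∈P f → b ∈P g
    to (le , tot) = bound , trans (sym (ℕ.m+n∸n≡m (total b) (f ⊤)))
      (trans (cong (_∸ f ⊤) (trans (cong (_+_ (total b)) (sym tot)) (b+a ⊤))) (sym g⊤))
      where
      bound : ∀ A → sumOver A b ≤ g A
      bound A = ℕ.m+n≤o⇒m≤o∸n (sumOver A b) (begin
        sumOver A b + f ⊤                            ≡⟨ cong (_+_ (sumOver A b)) (trans (sumOver-∁ A a) tot) ⟨
        sumOver A b + (sumOver A a + sumOver (∁ A) a) ≡⟨ ℕ.+-assoc (sumOver A b) _ _ ⟨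
        sumOver A b + sumOver A a + sumOver (∁ A) a  ≡⟨ cong (_+ sumOver (∁ A) a) (b+a A) ⟩
        sumOver A m + sumOver (∁ A) a                ≤⟨ ℕ.+-monoʳ-≤ (sumOver A m) (le (∁ A)) ⟩
        sumOver A m + f (∁ A)                        ∎)
        where open ℕ.≤-Reasoning
    from : b ∈P g → a ∈P f
    from (le , tot) = bound , total-a
      where
      total-a : total a ≡ f ⊤
      total-a = ℕ.+-cancelˡ-≡ (total b) _ _ (trans (b+a ⊤)
        (trans (sym (ℕ.m∸n+n≡m f⊤≤total)) (cong (_+ f ⊤) (sym (trans tot g⊤)))))
      bound : ∀ A → sumOver A a ≤ f A
      bound A = ℕ.+-cancelˡ-≤ (sumOver (∁ A) m) _ _ (begin
        sumOver (∁ A) m + sumOver A a                       ≡⟨ cong (_+ sumOver A a) (b+a (∁ A)) ⟨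
        sumOver (∁ A) b + sumOver (∁ A) a + sumOver A a     ≡⟨ ℕ.+-assoc (sumOver (∁ A) b) _ _ ⟩
        sumOver (∁ A) b + (sumOver (∁ A) a + sumOver A a)   ≡⟨ cong (_+_ (sumOver (∁ A) b))
                                                                 (trans (ℕ.+-comm _ (sumOver A a)) (trans (sumOver-∁ A a) total-a)) ⟩
        sumOver (∁ A) b + f ⊤                               ≤⟨ ℕ.+-monoˡ-≤ (f ⊤) (le (∁ A)) ⟩
        g (∁ A) + f ⊤                                       ≡⟨ g+f⊤ (∁ A) ⟩
        sumOver (∁ A) m + f (∁ (∁ A))                       ≡⟨ cong (λ B → sumOver (∁ A) m + f B) (¬-involutive A) ⟩
        sumOver (∁ A) m + f A                               ∎)
        where open ℕ.≤-Reasoning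

  -- If one of the two exchanges is not available, the other leaves the box { a ≤ m }.
  exchange-dual : ∀ a → a ≤ᵛ m → ∀ i j → i ≢ j → inP? f (minusPlus a i j) ≡ inP? g (minusPlus (m ∸ᵛ a) j i)
  exchange-dual a a≤m i j i≢j with lookup a i in ai | lookup (m ∸ᵛ a) j in bj
  ... | zero | zero = refl
  ... | zero | suc w = sym (Bool.¬-not (λ e → ℕ.<⇒≱ (ℕ.n<1+n (lookup m i))
    (subst (_≤ lookup m i) b′i (∈P-dual-bound (inP⇒∈P g _ e) i))))
    where
    b′i : lookup (updateAt (updateAt (m ∸ᵛ a) j (_∸ 1)) i suc) i ≡ suc (lookup m i)
    b′i = trans (lookup∘updateAt i {suc} (updateAt (m ∸ᵛ a) j (_∸ 1))) (cong suc (trans (lookup∘updateAt′ i j i≢j (m ∸ᵛ a))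
      (trans (lookup-zipWith _∸_ i m a) (cong (lookup m i ∸_) ai))))
  ... | suc w | zero = Bool.¬-not (λ e → ℕ.<⇒≱ (s≤s (ℕ.m∸n≡0⇒m≤n (trans (sym (lookup-zipWith _∸_ j m a)) bj)))
    (subst (_≤ lookup m j) a′j (∈P-bound (inP⇒∈P f _ e) j)))
    where
    a′j : lookup (updateAt (updateAt a i (_∸ 1)) j suc) j ≡ suc (lookup a j)
    a′j = trans (lookup∘updateAt j {suc} (updateAt a i (_∸ 1))) (cong suc (lookup∘updateAt′ j i (i≢j ∘ sym) a))
  ... | suc w | suc w′ = trans (inP-dual a′ a′≤m) (cong (inP g) b′)
    where
    a′ : Vec ℕ n
    a′ = updateAt (updateAt a i (_∸ 1)) j suc
    b′ : m ∸ᵛ a′ ≡ updateAt (updateAt (m ∸ᵛ a) j (_∸ 1)) i suc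
    b′ = trans (∸ᵛ-suc m (updateAt a i (_∸ 1)) j) (trans
      (cong (λ v → updateAt v j (_∸ 1)) (∸ᵛ-pred m a i ai a≤m))
      (updateAt-commutes j i (i≢j ∘ sym) (m ∸ᵛ a)))
    a′≤m : a′ ≤ᵛ m
    a′≤m l with l Fin.≟ j
    ... | yes refl = subst (_≤ lookup m j)
      (sym (trans (lookup∘updateAt j {suc} (updateAt a i (_∸ 1))) (cong suc (lookup∘updateAt′ j i (i≢j ∘ sym) a))))
      (ℕ.m∸n≢0⇒n<m (λ z → ℕ.1+n≢0 (trans (sym bj) (trans (lookup-zipWith _∸_ j m a) z))))
    ... | no l≢j = subst (_≤ lookup m l) (sym (lookup∘updateAt′ l j l≢j (updateAt a i (_∸ 1)))) (pred≤ l)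
      where
      pred≤ : ∀ l → lookup (updateAt a i (_∸ 1)) l ≤ lookup m l
      pred≤ l with l Fin.≟ i
      ... | yes refl = subst (_≤ lookup m i) (sym (lookup∘updateAt i a)) (ℕ.≤-trans (ℕ.m∸n≤m _ 1) (a≤m i))
      ... | no l≢i = subst (_≤ lookup m l) (sym (lookup∘updateAt′ l i l≢i a)) (a≤m l)

  Int-dual : ∀ a → a ≤ᵛ m → Int f a ≡ Ext g (m ∸ᵛ a)
  Int-dual a a≤m = tabulate-cong λ i → none-cong i (λ j → inP? f (minusPlus a i j))
    i (λ j → inP? g (minusPlus (m ∸ᵛ a) j i))
    (λ e j j<i → trans (sym (eq i j j<i)) (none⁻ _ _ e j j<i))
    (λ e j j<i → trans (eq i j j<i) (none⁻ _ _ e j j<i))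
    where
    eq : ∀ i j → toℕ j < toℕ i → inP? f (minusPlus a i j) ≡ inP? g (minusPlus (m ∸ᵛ a) j i)
    eq i j j<i = exchange-dual a a≤m i j (λ { refl → ℕ.<-irrefl refl j<i })

  intWeight : ℕ → Vec ℕ n → ℕ
  intWeight = weight (inP f) (λ a → codim (Int f a))

  weight-dual : ∀ k a → a ≤ᵛ m → intWeight k a ≡ extWeight g k (m ∸ᵛ a)
  weight-dual k a a≤m = cong₂ (λ p A → if p then (if codim A ≡ᵇ k then 1 else 0) else 0)
    (inP-dual a a≤m) (Int-dual a a≤m)

  weight-vanishes : ∀ (h : Subset n → ℕ) deg k → (∀ {a} → a ∈P h → a ≤ᵛ m) →
    ∀ v i → lookup m i < lookup v i → weight (inP h) deg k v ≡ 0
  weight-vanishes h deg k bound v i lt with inP h v in e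
  ... | false = refl
  ... | true = ⊥-elim (ℕ.<⇒≱ lt (bound (inP⇒∈P h v e) i))

  m≤f⊤ : ∀ i → lookup m i ≤ f ⊤
  m≤f⊤ i = subst (_≤ f ⊤) (sym (lookup∘tabulate _ i)) (monotone _ _ (⊆-max ⁅ i ⁆))

  -- The box bound has two duties: the summand `f ⊤` makes it dominate every entry of `m`, so that
  -- the box sum reduces to `capSum`, and `g ⊤` meets the requirement of `extCount-unimodal` for the
  -- dual.
  coeffI-dual : ∀ k → extCount (f ⊤ + g ⊤) g k ≡ coeffI f k
  coeffI-dual k = begin
    boxSum n (f ⊤ + g ⊤) (extWeight g k)
      ≡⟨ boxSum-capSum (f ⊤ + g ⊤) m (extWeight g k) (λ i → ℕ.≤-trans (m≤f⊤ i) (ℕ.m≤m+n _ _))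
           (weight-vanishes g (extDegree g) k ∈P-dual-bound) ⟩
    capSum m (extWeight g k)                    ≡⟨ capSum-reverse m (extWeight g k) ⟩
    capSum m (λ a → extWeight g k (m ∸ᵛ a))     ≡⟨ capSum-cong m (weight-dual k) ⟨
    capSum m (intWeight k)                      ≡⟨ boxSum-capSum (f ⊤) m (intWeight k) m≤f⊤ (weight-vanishes f (λ a → codim (Int f a)) k ∈P-bound) ⟨
    boxSum n (f ⊤) (intWeight k)                ≡⟨ length-filter (inP f) (λ a → codim (Int f a)) k (f ⊤) ⟨
    coeffI f k                                  ∎
    where open ≡-Reasoning

  -- The deficiency g ⊤ - g A equals the excess of the singleton ranks over `f` on `∁ A`, a set of
  -- size `codim A`. Complementation thus matches the sets minimised over in `r₂′ f` with those for
  -- `r₂` of the dual.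
  r₂′-near : NearlySpanning (r₂′ f) g
  r₂′-near A c = ℕ.+-cancelʳ-≤ (f ⊤) _ _ (begin
    g ⊤ + f ⊤                              ≡⟨ trans (cong (_+ f ⊤) g⊤) (ℕ.m∸n+n≡m f⊤≤total) ⟩
    total m                                ≡⟨ sumOver-∁ A m ⟨
    sumOver A m + sumOver (∁ A) m          ≤⟨ ℕ.+-monoʳ-≤ (sumOver A m) short ⟩
    sumOver A m + suc (f (∁ A))            ≡⟨ ℕ.+-suc (sumOver A m) _ ⟩
    suc (sumOver A m + f (∁ A))            ≡⟨ cong suc (g+f⊤ A) ⟨
    suc (g A) + f ⊤                        ∎)
    where
    open ℕ.≤-Reasoning
    short : sumOver (∁ A) m ≤ suc (f (∁ A))
    short = ℕ.≮⇒≥ λ lt → ℕ.<⇒≱ c (subst (r₂′ f ≤_) (∣∁p∣≡n∸∣p∣ A) (minOr-≤ (suc n) _ (∈-map⁺ ∣_∣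
      (∈-filter⁺ (λ F → f F + 2 ℕ.≤? singletonSum f F) (∈-allSubsets (∁ A))
        (subst (_≤ sumOver (∁ A) m) (ℕ.+-comm 2 (f (∁ A))) lt)))))

theorem4p2 : (n : ℕ) → 1 ≤ n → (f : Subset n → ℕ) → IsRankFunction n f →
    Unimodal (r₂ f) (coeffX f) × Unimodal (r₂′ f) (coeffI f)
theorem4p2 n _ f rank =
  Unimodal-cong (λ k → sym (length-filter (inP f) (extDegree f) k (f ⊤)))
    (extCount-unimodal f rank (r₂ f) (f ⊤) ℕ.≤-refl (r₂-near f)) ,
  Unimodal-cong coeffI-dual
    (extCount-unimodal g dual-isRankFunction (r₂′ f) (f ⊤ + g ⊤) (ℕ.m≤n+m (g ⊤) (f ⊤)) r₂′-near)
  where open Dual f rank
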